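{- Let $G$ be a graph of tree-width at most $w$. The problem of $k$-Anti-Path Cover admits an FPT algorithm parameterized by tree-width.
   Context: The $k$-Anti-Path Cover problem: given a graph $G$ and a positive integer $k$, decide whether the complement of $G$ is $k$-path coverable, i.e. whether the vertices of the complement $\overline{G}$ can be covered by at most $k$ vertex-disjoint paths in $\overline{G}$ (each vertex belongs to exactly one path). FPT means fixed-parameter tractable, i.e. solvable in time $f(w)\cdot n^{O(1)}$ for some computable function $f$, where $n$ is the number of vertices of $G$. -}

module Defs where

open import Data.Bool using (Bool; true; false; not; _∧_; T)
open import Data.Empty using (⊥-elim)
open import Data.Fin using (Fin; _≟_)
open import Data.Fin.Subset using (Subset; ∣_∣) renaming (_∈_ to _∈ˢ_)
open import Data.List using (List; []; _∷_; [_]; _++_; length; tabulate)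
open import Data.List.Membership.Propositional using (_∈_)
open import Data.List.Relation.Binary.Disjoint.Propositional using (Disjoint)
open import Data.List.Relation.Unary.All using (All)
open import Data.List.Relation.Unary.AllPairs using (AllPairs)
open import Data.List.Relation.Unary.Any using (Any)
open import Data.List.Relation.Unary.Linked using (Linked)
open import Data.List.Relation.Unary.Unique.Propositional using (Unique)
open import Data.Nat using (ℕ; zero; suc; _+_; _*_; _^_; _≤_; NonZero)
open import Data.Product using (Σ; ∃; ∃-syntax; _×_; _,_)
open import Data.Vec using (Vec; lookup; replicate; _[_]≔_; head)
  renaming (_∷_ to _∷ᵛ_)
open import Relation.Binary using (Rel)
open import Relation.Binary.Construct.Closure.ReflexiveTransitive using (Star)
open import Relation.Binary.PropositionalEquality using (_≡_; _≢_; refl; sym; cong; cong₂)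
open import Relation.Nullary using (¬_; Reflects; does; yes; no)

------------------------------------------------------------------------
-- Finite simple graphs

record Graph (n : ℕ) : Set where
  field
    adj         : Fin n → Fin n → Bool
    symmetric   : ∀ u v → adj u v ≡ adj v u
    irreflexive : ∀ v → adj v v ≡ false

  Adj : Rel (Fin n) _
  Adj u v = T (adj u v)

open Graph public

complement : ∀ {n} → Graph n → Graph n
complement {n} G = record
  { adj         = λ u v → not (does (u ≟ v)) ∧ not (adj G u v)
  ; symmetric   = λ u v → cong₂ (λ a b → not a ∧ not b) (≟-comm u v) (symmetric G u v)
  ; irreflexive = λ v → cong (λ a → not a ∧ not (adj G v v)) (≟-refl v)
  }
  where
  ≟-comm : (u v : Fin n) → does (u ≟ v) ≡ does (v ≟ u)
  ≟-comm u v with u ≟ v | v ≟ u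
  ... | yes _ | yes _ = refl
  ... | no  _ | no  _ = refl
  ... | yes p | no ¬q = ⊥-elim (¬q (sym p))
  ... | no ¬p | yes q = ⊥-elim (¬p (sym q))

  ≟-refl : (v : Fin n) → does (v ≟ v) ≡ true
  ≟-refl v with v ≟ v
  ... | yes _ = refl
  ... | no ¬p = ⊥-elim (¬p refl)

-- A path is given by its sequence of vertices; a single vertex is a path.
record IsPath {n} (G : Graph n) (xs : List (Fin n)) : Set where
  field
    nonempty : xs ≢ []
    distinct : Unique xs
    linked   : Linked (Adj G) xs

record PathCover {n} (G : Graph n) (k : ℕ) : Set where
  field
    paths    : List (List (Fin n))
    atMost   : length paths ≤ k
    arePaths : All (IsPath G) paths
    disjoint : AllPairs Disjoint paths
    covers   : ∀ v → Any (v ∈_) paths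

------------------------------------------------------------------------
-- Tree-width

Connected : ∀ {n} → Graph n → Set
Connected G = ∀ u v → Star (Adj G) u v

-- The cycle visiting v and then vs, and returning to v.
record IsCycle {n} (G : Graph n) (v : Fin n) (vs : List (Fin n)) : Set where
  field
    atLeast3 : 3 ≤ length (v ∷ vs)
    distinct : Unique (v ∷ vs)
    closed   : Linked (Adj G) (v ∷ vs ++ [ v ])

Acyclic : ∀ {n} → Graph n → Set
Acyclic G = ∀ v vs → ¬ IsCycle G v vs

record IsTree {m} (G : Graph m) : Set where
  field
    nonempty  : NonZero m
    connected : Connected G
    acyclic   : Acyclic G

record TreeDecomposition {n} (G : Graph n) : Set where
  field
    {nodes}    : ℕ
    tree       : Graph nodes
    isTree     : IsTree tree
    bag        : Fin nodes → Subset n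
    vertexIn   : ∀ v → ∃[ t ] v ∈ˢ bag t
    edgeIn     : ∀ u v → Adj G u v → ∃[ t ] (u ∈ˢ bag t × v ∈ˢ bag t)

  InBags : Fin n → Rel (Fin nodes) _
  InBags v s t = Adj tree s t × v ∈ˢ bag s × v ∈ˢ bag t

  field
    -- The nodes whose bag contains v induce a connected subgraph of the tree.
    coherent   : ∀ v s t → v ∈ˢ bag s → v ∈ˢ bag t → Star (InBags v) s t

-- The width is the maximum bag size minus one.
WidthAtMost : ∀ {n} {G : Graph n} → TreeDecomposition G → ℕ → Set
WidthAtMost D w = ∀ t → ∣ bag t ∣ ≤ suc w
  where open TreeDecomposition D

TreeWidthAtMost : ∀ {n} → Graph n → ℕ → Set
TreeWidthAtMost G w = Σ (TreeDecomposition G) λ D → WidthAtMost D w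

------------------------------------------------------------------------
-- Model of computation: the WHILE language of N. D. Jones, "Computability
-- and Complexity from a Programming Perspective", over binary trees, with
-- its unit-cost time measure.  A tree can be tested only for being nil, so
-- values may be shared and running times agree with those of Turing machines
-- and (logarithmic-cost) RAMs up to a polynomial.

infixr 5 _∙_

data Tree : Set where
  nil : Tree
  _∙_ : Tree → Tree → Tree

hd tl : Tree → Tree
hd nil     = nil
hd (a ∙ _) = a
tl nil     = nil
tl (_ ∙ b) = b

data Expr (v : ℕ) : Set where
  var   : Fin v → Expr v
  nilᵉ  : Expr v
  consᵉ : Expr v → Expr v → Expr v
  hdᵉ   : Expr v → Expr v
  tlᵉ   : Expr v → Expr v

infix  4 _≔_
infixr 3 _⨾_

data Command (v : ℕ) : Set where
  _≔_           : Fin v → Expr v → Command v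
  _⨾_           : Command v → Command v → Command v
  if_then_else_ : Expr v → Command v → Command v → Command v
  while_loop_   : Expr v → Command v → Command v

Store : ℕ → Set
Store v = Vec Tree v

eval : ∀ {v} → Expr v → Store v → Tree
eval (var x)     σ = lookup σ x
eval nilᵉ        σ = nil
eval (consᵉ d e) σ = eval d σ ∙ eval e σ
eval (hdᵉ e)     σ = hd (eval e σ)
eval (tlᵉ e)     σ = tl (eval e σ)

cost : ∀ {v} → Expr v → ℕ
cost (var x)     = 1
cost nilᵉ        = 1
cost (consᵉ d e) = 1 + cost d + cost e
cost (hdᵉ e)     = 1 + cost e
cost (tlᵉ e)     = 1 + cost e

infix 2 _,_⇓[_]_

-- c , σ ⇓[ t ] τ: started in store σ, c terminates in store τ after time t.
-- In conditions nil is false and every other tree is true.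
data _,_⇓[_]_ {v} : Command v → Store v → ℕ → Store v → Set where
  assign : ∀ {x e σ} →
           (x ≔ e) , σ ⇓[ 1 + cost e ] (σ [ x ]≔ eval e σ)
  seq    : ∀ {c d σ τ υ s t} →
           c , σ ⇓[ s ] τ → d , τ ⇓[ t ] υ →
           (c ⨾ d) , σ ⇓[ s + t ] υ
  ifᵗ    : ∀ {e c d σ τ t a b} → eval e σ ≡ a ∙ b →
           c , σ ⇓[ t ] τ →
           (if e then c else d) , σ ⇓[ 1 + cost e + t ] τ
  ifᶠ    : ∀ {e c d σ τ t} → eval e σ ≡ nil →
           d , σ ⇓[ t ] τ →
           (if e then c else d) , σ ⇓[ 1 + cost e + t ] τ
  whileᵗ : ∀ {e c σ τ υ s t a b} → eval e σ ≡ a ∙ b →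
           c , σ ⇓[ s ] τ → (while e loop c) , τ ⇓[ t ] υ →
           (while e loop c) , σ ⇓[ 1 + cost e + s + t ] υ
  whileᶠ : ∀ {e c σ} → eval e σ ≡ nil →
           (while e loop c) , σ ⇓[ 1 + cost e ] σ

-- Input and output are held in the first variable; all others start as nil.
record Program : Set where
  constructor program
  field
    {aux} : ℕ
    body  : Command (suc aux)

record Run (p : Program) (input output : Tree) : Set where
  open Program p
  field
    time   : ℕ
    final  : Store (suc aux)
    run    : body , (input ∷ᵛ replicate aux nil) ⇓[ time ] final
    result : head final ≡ output

RunWithin : Program → ℕ → Tree → Tree → Set
RunWithin p bound input output = Σ (Run p input output) λ r → Run.time r ≤ bound

codeBool : Bool → Tree
codeBool false = nil
codeBool true  = nil ∙ nil

codeℕ : ℕ → Tree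
codeℕ zero    = nil
codeℕ (suc m) = nil ∙ codeℕ m

codeList : List Tree → Tree
codeList []       = nil
codeList (x ∷ xs) = x ∙ codeList xs

codeGraph : ∀ {n} → Graph n → Tree
codeGraph G = codeList (tabulate λ u → codeList (tabulate λ v → codeBool (adj G u v)))

Computable : (ℕ → ℕ) → Set
Computable f = ∃[ p ] (∀ x → Run p (codeℕ x) (codeℕ (f x)))

------------------------------------------------------------------------
-- Fixed-parameter tractability

record ParameterizedProblem : Set₁ where
  field
    Instance    : Set
    code        : Instance → Tree
    size        : Instance → ℕ
    ParamAtMost : Instance → ℕ → Set
    Yes         : Instance → Set

-- The program does not receive w.  The factor n ^ c is written with suc n in
-- place of n, which only makes a difference when n = 0, up to the constant
-- 2 ^ c, which f absorbs.
FPT : ParameterizedProblem → Set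
FPT P = ∃[ p ] ∃[ f ] ∃[ c ] (Computable f ×
          (∀ x w → ParamAtMost x w →
             ∃[ b ] (RunWithin p (f w * suc (size x) ^ c) (code x) (codeBool b)
                     × Reflects (Yes x) b)))
  where open ParameterizedProblem P

record GraphAndNumber : Set where
  field
    {n}      : ℕ
    graph    : Graph n
    k        : ℕ
    positive : NonZero k

-- As running time is measured in the number of vertices only, the unary
-- encoding of k grants no additional time.
AntiPathCover-by-TreeWidth : ParameterizedProblem
AntiPathCover-by-TreeWidth = record
  { Instance    = GraphAndNumber
  ; code        = λ x → codeGraph (graph x) ∙ codeℕ (k x)
  ; size        = n
  ; ParamAtMost = λ x w → TreeWidthAtMost (graph x) w
  ; Yes         = λ x → PathCover (complement (graph x)) (k x)
  }
  where open GraphAndNumber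

-- A path cover of the complement by k paths is an ordering of the vertices with fewer than k breaks,
-- i.e. consecutive pairs that are adjacent in G.  Call v high if n ≤ 2 deg v.  By a rotation argument
-- as in the Bondy–Chvátal closure, an ordering can be rearranged until no break joins two low
-- vertices, so pairs of low vertices may be ignored.  Tree-width at most w gives at most 2n(w + 1)
-- ordered adjacent pairs, hence at most 4(w + 1) high vertices.  After the closure low vertices with the same
-- high neighbours are interchangeable, and of each such class at most 2h + 1 need to be kept, h being
-- the number of high vertices.  The orderings of the remaining kernel, whose size depends on w only,
-- are tried one by one.
--
-- For the running time, a program composed of folds over lists takes time polynomial in the length of
-- the longest list folded over; here only the list of orderings is longer than n.

{-# OPTIONS --safe #-}
module Submission where

open import Defs
open import Data.Bool using (Bool; true; false; T; not; _∧_; _∨_) renaming (if_then_else_ to ifᵇ_then_else_)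
open import Data.Bool.Properties using (∧-assoc; ∧-zeroʳ; ∧-identityʳ; ∨-comm; ∨-zeroʳ)
open import Data.Empty using (⊥-elim)
open import Data.Fin using (Fin; zero; suc; toℕ; _≟_)
open import Data.Fin.Properties using (any?; toℕ<n)
open import Data.Fin.Subset using (Subset; ∣_∣) renaming (_∈_ to _∈ˢ_)
open import Data.Fin.Subset.Properties using () renaming (_∈?_ to _∈ˢ?_)
open import Data.List hiding (sum; lookup)
open import Data.List.Properties using
  (length-++; length-map; length-replicate; length-reverse; length-tabulate; map-tabulate; reverse-involutive; ++-identityʳ)
  renaming (++-assoc to ++ₗ-assoc)
open import Data.List.Membership.Propositional using (_∈_; _∉_)
open import Data.List.Membership.Propositional.Properties using
  (∈-∃++; ∈-++⁺ˡ; ∈-++⁺ʳ; ∈-allFin; ∈-concat⁺; ∈-concat⁻; ∈-concat⁺′; ∈-map⁺)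
open import Data.List.Membership.Propositional.Properties.WithK using (unique∧set⇒bag)
open import Data.List.Relation.Binary.BagAndSetEquality using (∼bag⇒↭)
open import Data.List.Relation.Binary.Disjoint.Propositional using (Disjoint)
open import Data.List.Relation.Binary.Permutation.Propositional
  using (_↭_; prep; swap; ↭-refl; ↭-reflexive; ↭-sym; ↭-trans; ↭⇒↭ₛ; module PermutationReasoning)
  renaming (refl to ↭-refl′; trans to ↭-trans′)
open import Data.List.Relation.Binary.Permutation.Propositional.Properties using
  (All-resp-↭; drop-mid; map⁺; shift; ∈-resp-↭; ↭-empty-inv; ↭-length; ↭-map-inv; ++-comm; ++⁺ʳ)
import Data.List.Relation.Binary.Permutation.Setoid.Properties as Permutationₛ
open import Data.List.Relation.Unary.All as All using (All; []; _∷_)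
open import Data.List.Relation.Unary.All.Properties using (tabulate⁺; ¬Any⇒All¬)
open import Data.List.Relation.Unary.AllPairs using (AllPairs; []; _∷_)
open import Data.List.Relation.Unary.Any using (here; there)
open import Data.List.Relation.Unary.Linked using (Linked; []; [-]; _∷_)
open import Data.List.Relation.Unary.Unique.Propositional using (Unique)
open import Data.List.Relation.Unary.Unique.Propositional.Properties using (allFin⁺; concat⁺)
open import Data.Nat hiding (_≟_)
open import Data.Nat.Induction using (Acc; <-wellFounded) renaming (acc to accessible)
open import Data.Nat.Properties hiding (_≟_)
open import Algebra.Properties.CommutativeSemigroup +-commutativeSemigroup using (interchange)
open import Data.Product using (∃; ∃-syntax; _×_; _,_; proj₁; proj₂)
open import Data.Sum using (_⊎_; inj₁; inj₂)
open import Data.Unit using (⊤; tt)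
open import Data.Vec as Vec using ([]; _∷_)
open import Data.Vec.Properties using ([]=⇒lookup)
open import Function using (_∘_; id; mk⇔)
open import Relation.Binary.Construct.Closure.ReflexiveTransitive using (Star; ε; _◅_)
open import Relation.Binary.PropositionalEquality hiding ([_])
open import Relation.Nullary
open import Relation.Nullary.Decidable using (_×-dec_)

-- Two low vertices u, v satisfy deg u + deg v < n, so their degrees in the complement sum to at
-- least n - 1. This is Ore's threshold, at which joining u and v leaves the path cover number
-- unchanged. Each rotation lowers the number of all breaks and never raises the number of those
-- with a high end, so rotating terminates without losing ground.
--
-- The constant 2h + 1: in an ordering at most 2h places lie next to a high vertex, so of 2h + 1
-- interchangeable low vertices one has no high neighbour. Deleting it brings only low vertices
-- together, which costs nothing; conversely, a further copy put beside its twin costs nothing.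
--
-- The program is given neither w nor a tree decomposition. Hence h, which can be counted, sets the
-- threshold, and the decomposition serves to bound h alone: rooted, it puts one end of each edge
-- into the topmost bag of the other, so there are at most n(w + 1) edges.
--
-- The traversed lists have length at most F(w) + n for a computable F. As 1 + a + n is at most (1 +
-- a)(1 + n), a polynomial in this sum splits into f(w) times a power of n + 1.

-- A language of folds and its compilation to WHILE programs

infixr 5 _∙ᶠ_
infixr 6 _∘ᶠ_

-- In foldᶠ l a f the body f receives (element ∙ accumulator) ∙ argument.
data Fun : Set where
  arg nilᶠ : Fun
  hdᶠ tlᶠ  : Fun → Fun
  _∙ᶠ_     : Fun → Fun → Fun
  _∘ᶠ_     : Fun → Fun → Fun
  condᶠ    : Fun → Fun → Fun → Fun
  foldᶠ    : Fun → Fun → Fun → Fun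

ite : ∀ {a} {A : Set a} → Tree → A → A → A
ite nil     x y = y
ite (_ ∙ _) x y = x

iter : (Tree → Tree) → Tree → Tree → Tree → Tree
iter g x nil      a = a
iter g x (y ∙ ys) a = iter g x ys (g ((y ∙ a) ∙ x))

⟦_⟧ : Fun → Tree → Tree
⟦ arg ⟧         x = x
⟦ nilᶠ ⟧        x = nil
⟦ hdᶠ f ⟧       x = hd (⟦ f ⟧ x)
⟦ tlᶠ f ⟧       x = tl (⟦ f ⟧ x)
⟦ f ∙ᶠ g ⟧      x = ⟦ f ⟧ x ∙ ⟦ g ⟧ x
⟦ g ∘ᶠ f ⟧      x = ⟦ g ⟧ (⟦ f ⟧ x)
⟦ condᶠ c f g ⟧ x = ite (⟦ c ⟧ x) (⟦ f ⟧ x) (⟦ g ⟧ x)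
⟦ foldᶠ l a f ⟧ x = iter ⟦ f ⟧ x (⟦ l ⟧ x) (⟦ a ⟧ x)

val stk : Fin 2
val = zero
stk = suc zero

x̂ ŝ : Expr 2
x̂ = var val
ŝ = var stk

-- There are only two variables, so the value of `c` and the saved argument trade places through a
-- temporary pair in `val`.
pair : Command 2 → Command 2 → Command 2
pair c d = stk ≔ consᵉ x̂ ŝ ⨾ c ⨾ val ≔ consᵉ x̂ (hdᵉ ŝ) ⨾ stk ≔ consᵉ (hdᵉ x̂) (tlᵉ ŝ) ⨾ val ≔ tlᵉ x̂ ⨾
           d ⨾ val ≔ consᵉ (hdᵉ ŝ) x̂ ⨾ stk ≔ tlᵉ ŝ

-- val holds argument ∙ list ∙ accumulator before each iteration.
traverse : Command 2 → Command 2
traverse c = while hdᵉ (tlᵉ x̂) loop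
  ( stk ≔ consᵉ (consᵉ (hdᵉ x̂) (tlᵉ (hdᵉ (tlᵉ x̂)))) ŝ ⨾
    val ≔ consᵉ (consᵉ (hdᵉ (hdᵉ (tlᵉ x̂))) (tlᵉ (tlᵉ x̂))) (hdᵉ x̂) ⨾
    c ⨾
    val ≔ consᵉ (hdᵉ (hdᵉ ŝ)) (consᵉ (tlᵉ (hdᵉ ŝ)) x̂) ⨾
    stk ≔ tlᵉ ŝ )

-- val holds the argument and then the value; stk is a stack, restored at the end.
compile : Fun → Command 2
compile arg           = val ≔ x̂
compile nilᶠ          = val ≔ nilᵉ
compile (hdᶠ f)       = compile f ⨾ val ≔ hdᵉ x̂
compile (tlᶠ f)       = compile f ⨾ val ≔ tlᵉ x̂
compile (f ∙ᶠ g)      = pair (compile f) (compile g)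
compile (g ∘ᶠ f)      = compile f ⨾ compile g
compile (condᶠ c f g) = stk ≔ consᵉ x̂ ŝ ⨾ compile c ⨾ val ≔ consᵉ x̂ (hdᵉ ŝ) ⨾ stk ≔ tlᵉ ŝ ⨾
  (if hdᵉ x̂ then (val ≔ tlᵉ x̂ ⨾ compile f) else (val ≔ tlᵉ x̂ ⨾ compile g))
compile (foldᶠ l a f) =
  pair (val ≔ x̂) (pair (compile l) (compile a)) ⨾ traverse (compile f) ⨾ val ≔ tlᵉ (tlᵉ x̂)

-- The constants are the costs of the assignments in `pair`, in order of execution and associated as
-- in the rule `seq`; the derivations below then have this time by computation.
pairTime : ℕ → ℕ → ℕ
pairTime s t = 4 + (s + (5 + (6 + (3 + (t + 8)))))

loopTime : (Tree → Tree) → (Tree → ℕ) → Tree → Tree → Tree → ℕ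
loopTime g t x nil      a = 4
loopTime g t x (y ∙ ys) a =
  4 + (10 + (12 + (t ((y ∙ a) ∙ x) + 13))) + loopTime g t x ys (g ((y ∙ a) ∙ x))

time : Fun → Tree → ℕ
time arg           x = 2
time nilᶠ          x = 2
time (hdᶠ f)       x = time f x + 3
time (tlᶠ f)       x = time f x + 3
time (f ∙ᶠ g)      x = pairTime (time f x) (time g x)
time (g ∘ᶠ f)      x = time f x + time g (⟦ f ⟧ x)
time (condᶠ c f g) x = 4 + (time c x + (5 + (3 + (3 + (3 + ite (⟦ c ⟧ x) (time f x) (time g x))))))
time (foldᶠ l a f) x = pairTime 2 (pairTime (time l x) (time a x)) +
                       (loopTime ⟦ f ⟧ (time f) x (⟦ l ⟧ x) (⟦ a ⟧ x) + 4)

Runs : Command 2 → (Tree → Tree) → (Tree → ℕ) → Set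
Runs c g t = ∀ x s → c , x ∷ s ∷ [] ⇓[ t x ] (g x ∷ s ∷ [])

pair-runs : ∀ {c d g h s t} → Runs c g s → Runs d h t →
            Runs (pair c d) (λ x → g x ∙ h x) (λ x → pairTime (s x) (t x))
pair-runs p q x s =
  seq assign (seq (p _ _) (seq assign (seq assign (seq assign (seq (q _ _) (seq assign assign))))))

loop-runs : ∀ {c g t} → Runs c g t → ∀ x l a s →
            traverse c , (x ∙ l ∙ a) ∷ s ∷ [] ⇓[ loopTime g t x l a ] ((x ∙ nil ∙ iter g x l a) ∷ s ∷ [])
loop-runs p x nil      a s = whileᶠ refl
loop-runs p x (y ∙ ys) a s =
  whileᵗ refl (seq assign (seq assign (seq (p _ _) (seq assign assign)))) (loop-runs p x ys _ s)

compile-runs : ∀ f → Runs (compile f) ⟦ f ⟧ (time f)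
compile-runs arg           x s = assign
compile-runs nilᶠ          x s = assign
compile-runs (hdᶠ f)       x s = seq (compile-runs f x s) assign
compile-runs (tlᶠ f)       x s = seq (compile-runs f x s) assign
compile-runs (f ∙ᶠ g)          = pair-runs (compile-runs f) (compile-runs g)
compile-runs (g ∘ᶠ f)      x s = seq (compile-runs f x s) (compile-runs g _ s)
compile-runs (condᶠ c f g) x s =
  seq assign (seq (compile-runs c x _) (seq assign (seq assign branch)))
  where
  branch : (if hdᵉ x̂ then (val ≔ tlᵉ x̂ ⨾ compile f) else (val ≔ tlᵉ x̂ ⨾ compile g)) ,
           ((⟦ c ⟧ x ∙ x) ∷ s ∷ [])
           ⇓[ 3 + (3 + ite (⟦ c ⟧ x) (time f x) (time g x)) ]
           (ite (⟦ c ⟧ x) (⟦ f ⟧ x) (⟦ g ⟧ x) ∷ s ∷ [])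
  branch with ⟦ c ⟧ x
  ... | nil   = ifᶠ refl (seq assign (compile-runs g x s))
  ... | _ ∙ _ = ifᵗ refl (seq assign (compile-runs f x s))
compile-runs (foldᶠ l a f) x s =
  seq (pair-runs (λ _ _ → assign) (pair-runs (compile-runs l) (compile-runs a)) x s)
      (seq (loop-runs (compile-runs f) x _ _ s) assign)

toProgram : Fun → Program
toProgram f = program (compile f)

toRun : ∀ f x {y} → ⟦ f ⟧ x ≡ y → Run (toProgram f) x y
toRun f x eq = record { run = compile-runs f x nil ; result = eq }

-- Running times

spine : Tree → ℕ
spine nil     = 0
spine (_ ∙ t) = suc (spine t)

IterBounded : (Tree → Set) → (Tree → Tree) → Tree → Tree → Tree → Set
IterBounded B g x nil      a = ⊤
IterBounded B g x (y ∙ ys) a = B ((y ∙ a) ∙ x) × IterBounded B g x ys (g ((y ∙ a) ∙ x))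

-- Every list traversed by a fold during the evaluation has length at most N.
Bounded : ℕ → Fun → Tree → Set
Bounded N arg           x = ⊤
Bounded N nilᶠ          x = ⊤
Bounded N (hdᶠ f)       x = Bounded N f x
Bounded N (tlᶠ f)       x = Bounded N f x
Bounded N (f ∙ᶠ g)      x = Bounded N f x × Bounded N g x
Bounded N (g ∘ᶠ f)      x = Bounded N f x × Bounded N g (⟦ f ⟧ x)
Bounded N (condᶠ c f g) x = Bounded N c x × Bounded N f x × Bounded N g x
Bounded N (foldᶠ l a f) x = Bounded N l x × Bounded N a x × spine (⟦ l ⟧ x) ≤ N ×
                            IterBounded (Bounded N f) ⟦ f ⟧ x (⟦ l ⟧ x) (⟦ a ⟧ x)

-- Only a fold multiplies by `N`, so this is a polynomial for each fixed program. One round of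
-- `traverse` costs 39 apart from its body; the 8 is the failing test and the last assignment. A
-- conditional is charged for both branches, whence the sum.
cap : Fun → ℕ → ℕ
cap arg           N = 2
cap nilᶠ          N = 2
cap (hdᶠ f)       N = cap f N + 3
cap (tlᶠ f)       N = cap f N + 3
cap (f ∙ᶠ g)      N = pairTime (cap f N) (cap g N)
cap (g ∘ᶠ f)      N = cap f N + cap g N
cap (condᶠ c f g) N = 18 + (cap c N + (cap f N + cap g N))
cap (foldᶠ l a f) N = pairTime 2 (pairTime (cap l N) (cap a N)) + (N * (39 + cap f N) + 8)

pairTime-mono : ∀ {s s′ t t′} → s ≤ s′ → t ≤ t′ → pairTime s t ≤ pairTime s′ t′
pairTime-mono p q = +-monoʳ-≤ 4 (+-mono-≤ p (+-monoʳ-≤ 14 (+-monoˡ-≤ 8 q)))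

loopTime≤ : ∀ {B g t c} → (∀ x → B x → t x ≤ c) → ∀ x l a {N} → spine l ≤ N →
            IterBounded B g x l a → loopTime g t x l a ≤ N * (39 + c) + 4
loopTime≤ h x nil      a {N} _ _ = m≤n+m 4 (N * _)
loopTime≤ {g = g} {t} {c} h x (y ∙ ys) a {suc N} (s≤s le) (b , bs) = begin
  26 + (t _ + 13) + loopTime g t x ys _ ≤⟨ +-mono-≤ step (loopTime≤ h x ys _ le bs) ⟩
  (39 + c) + (N * (39 + c) + 4)         ≡⟨ +-assoc (39 + c) _ 4 ⟨
  (39 + c) + N * (39 + c) + 4           ∎
  where
  open ≤-Reasoning
  step : 26 + (t ((y ∙ a) ∙ x) + 13) ≤ 39 + c
  step = +-monoʳ-≤ 26 (≤-trans (+-monoˡ-≤ 13 (h _ b)) (≤-reflexive (+-comm c 13)))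

time≤cap : ∀ f {N x} → Bounded N f x → time f x ≤ cap f N
time≤cap arg           _ = ≤-refl
time≤cap nilᶠ          _ = ≤-refl
time≤cap (hdᶠ f)       b = +-monoˡ-≤ 3 (time≤cap f b)
time≤cap (tlᶠ f)       b = +-monoˡ-≤ 3 (time≤cap f b)
time≤cap (f ∙ᶠ g)      (b , c) = pairTime-mono (time≤cap f b) (time≤cap g c)
time≤cap (g ∘ᶠ f)      (b , c) = +-mono-≤ (time≤cap f b) (time≤cap g c)
time≤cap (condᶠ c f g) {N} {x} (b , b₁ , b₂) = begin
  4 + (time c x + (14 + r))              ≤⟨ +-monoʳ-≤ 4 (+-mono-≤ (time≤cap c b) (+-monoʳ-≤ 14 branch)) ⟩
  4 + (cap c N + (14 + (cap f N + cap g N))) ≡⟨ cong (4 +_) (trans (sym (+-assoc (cap c N) 14 _)) (cong (_+ (cap f N + cap g N)) (+-comm (cap c N) 14))) ⟩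
  18 + (cap c N + (cap f N + cap g N))   ∎
  where
  open ≤-Reasoning
  r : ℕ
  r = ite (⟦ c ⟧ x) (time f x) (time g x)
  branch : r ≤ cap f N + cap g N
  branch with ⟦ c ⟧ x
  ... | nil   = ≤-trans (time≤cap g b₂) (m≤n+m _ _)
  ... | _ ∙ _ = ≤-trans (time≤cap f b₁) (m≤m+n _ _)
time≤cap (foldᶠ l a f) {N} {x} (b , b₁ , le , bs) =
  +-mono-≤ (pairTime-mono {2} ≤-refl (pairTime-mono (time≤cap l b) (time≤cap a b₁)))
    (≤-trans (+-monoˡ-≤ 4 (loopTime≤ (λ y → time≤cap f {x = y}) x _ _ le bs))
             (≤-reflexive (+-assoc (N * (39 + cap f N)) 4 4)))

-- The base `suc N` is positive, so exponents may be enlarged; for sums and products it then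
-- suffices to add them.
Poly : (ℕ → ℕ) → Set
Poly g = ∃[ c ] ∃[ d ] (∀ N → g N ≤ c * suc N ^ d)

poly-const : ∀ m → Poly (λ _ → m)
poly-const m = m , 0 , λ _ → ≤-reflexive (sym (*-identityʳ m))

poly-id : Poly (λ N → N)
poly-id = 1 , 1 , λ N → ≤-trans (n≤1+n N) (≤-reflexive (sym (trans (*-identityˡ _) (*-identityʳ _))))

poly-+ : ∀ {g h} → Poly g → Poly h → Poly (λ N → g N + h N)
poly-+ {g} {h} (c , d , p) (c′ , d′ , q) = c + c′ , d + d′ , λ N → begin
  g N + h N                                   ≤⟨ +-mono-≤ (p N) (q N) ⟩
  c * suc N ^ d + c′ * suc N ^ d′             ≤⟨ +-mono-≤ (*-monoʳ-≤ c (^-monoʳ-≤ (suc N) (m≤m+n d d′)))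
                                                          (*-monoʳ-≤ c′ (^-monoʳ-≤ (suc N) (m≤n+m d′ d))) ⟩
  c * suc N ^ (d + d′) + c′ * suc N ^ (d + d′) ≡⟨ *-distribʳ-+ (suc N ^ (d + d′)) c c′ ⟨
  (c + c′) * suc N ^ (d + d′)                 ∎
  where open ≤-Reasoning

poly-* : ∀ {g h} → Poly g → Poly h → Poly (λ N → g N * h N)
poly-* {g} {h} (c , d , p) (c′ , d′ , q) = c * c′ , d + d′ , λ N → begin
  g N * h N                           ≤⟨ *-mono-≤ (p N) (q N) ⟩
  (c * suc N ^ d) * (c′ * suc N ^ d′) ≡⟨ [m*n]*[o*p]≡[m*o]*[n*p] c (suc N ^ d) c′ (suc N ^ d′) ⟩
  (c * c′) * (suc N ^ d * suc N ^ d′) ≡⟨ cong (c * c′ *_) (^-distribˡ-+-* (suc N) d d′) ⟨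
  (c * c′) * suc N ^ (d + d′)         ∎
  where open ≤-Reasoning

poly-pair : ∀ {g h} → Poly g → Poly h → Poly (λ N → pairTime (g N) (h N))
poly-pair p q = poly-+ (poly-const 4) (poly-+ p (poly-+ (poly-const 14) (poly-+ q (poly-const 8))))

poly-cap : ∀ f → Poly (cap f)
poly-cap arg           = poly-const 2
poly-cap nilᶠ          = poly-const 2
poly-cap (hdᶠ f)       = poly-+ (poly-cap f) (poly-const 3)
poly-cap (tlᶠ f)       = poly-+ (poly-cap f) (poly-const 3)
poly-cap (f ∙ᶠ g)      = poly-pair (poly-cap f) (poly-cap g)
poly-cap (g ∘ᶠ f)      = poly-+ (poly-cap f) (poly-cap g)
poly-cap (condᶠ c f g) = poly-+ (poly-const 18) (poly-+ (poly-cap c) (poly-+ (poly-cap f) (poly-cap g)))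
poly-cap (foldᶠ l a f) =
  poly-+ (poly-pair (poly-const 2) (poly-pair (poly-cap l) (poly-cap a)))
         (poly-+ (poly-* poly-id (poly-+ (poly-const 39) (poly-cap f))) (poly-const 8))

-- Arithmetic in unary

_Computes_ : Fun → (ℕ → ℕ) → Set
f Computes g = ∀ m → ⟦ f ⟧ (codeℕ m) ≡ codeℕ (g m)

computable : ∀ {g} → ∃ (_Computes g) → Computable g
computable (f , eq) = toProgram f , λ m → toRun f (codeℕ m) (eq m)

const-computes : ∀ n → ∃ (_Computes (λ _ → n))
const-computes zero    = nilᶠ , λ _ → refl
const-computes (suc n) = let f , eq = const-computes n in nilᶠ ∙ᶠ f , λ m → cong (nil ∙_) (eq m)

id-computes : ∃ (_Computes (λ m → m))
id-computes = arg , λ _ → refl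

addᶠ mulᶠ powᶠ : Fun
addᶠ = foldᶠ (hdᶠ arg) (tlᶠ arg) (nilᶠ ∙ᶠ tlᶠ (hdᶠ arg))
mulᶠ = foldᶠ (hdᶠ arg) nilᶠ (addᶠ ∘ᶠ (tlᶠ (tlᶠ arg) ∙ᶠ tlᶠ (hdᶠ arg)))
powᶠ = foldᶠ (tlᶠ arg) (nilᶠ ∙ᶠ nilᶠ) (mulᶠ ∘ᶠ (hdᶠ (tlᶠ arg) ∙ᶠ tlᶠ (hdᶠ arg)))

add-iter : ∀ x m n → iter (⟦ nilᶠ ∙ᶠ tlᶠ (hdᶠ arg) ⟧) x (codeℕ m) (codeℕ n) ≡ codeℕ (m + n)
add-iter x zero    n = refl
add-iter x (suc m) n = trans (add-iter x m (suc n)) (cong codeℕ (+-suc m n))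

mul-iter : ∀ x n m k → iter ⟦ addᶠ ∘ᶠ (tlᶠ (tlᶠ arg) ∙ᶠ tlᶠ (hdᶠ arg)) ⟧ (x ∙ codeℕ n) (codeℕ m) (codeℕ k)
           ≡ codeℕ (m * n + k)
mul-iter x n zero    k = refl
mul-iter x n (suc m) k
  rewrite add-iter (codeℕ n ∙ codeℕ k) n k
  = trans (mul-iter x n m (n + k)) (cong codeℕ (trans (sym (+-assoc (m * n) n k)) (cong (_+ k) (+-comm (m * n) n))))

pow-iter : ∀ x n m k → iter ⟦ mulᶠ ∘ᶠ (hdᶠ (tlᶠ arg) ∙ᶠ tlᶠ (hdᶠ arg)) ⟧ (codeℕ n ∙ x) (codeℕ m) (codeℕ k)
           ≡ codeℕ (n ^ m * k)
pow-iter x n zero    k = cong codeℕ (sym (+-identityʳ k))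
pow-iter x n (suc m) k
  rewrite mul-iter (codeℕ n) k n 0 | +-identityʳ (n * k)
  = trans (pow-iter x n m (n * k))
          (cong codeℕ (trans (sym (*-assoc (n ^ m) n k)) (cong (_* k) (*-comm (n ^ m) n))))

infixl 6 _+ᶜ_
infixl 7 _*ᶜ_
infixr 8 _^ᶜ_

-- `FPT` asks for a computable bound; an expression over these operators carries its own program.
_+ᶜ_ : ∀ {g h} → ∃ (_Computes g) → ∃ (_Computes h) → ∃ (_Computes (λ m → g m + h m))
_+ᶜ_ {g} {h} (p , eq) (q , eq′) = addᶠ ∘ᶠ (p ∙ᶠ q) , correct
  where
  correct : (addᶠ ∘ᶠ (p ∙ᶠ q)) Computes (λ m → g m + h m)
  correct m rewrite eq m | eq′ m = add-iter _ (g m) (h m)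

_*ᶜ_ : ∀ {g h} → ∃ (_Computes g) → ∃ (_Computes h) → ∃ (_Computes (λ m → g m * h m))
_*ᶜ_ {g} {h} (p , eq) (q , eq′) = mulᶠ ∘ᶠ (p ∙ᶠ q) , correct
  where
  correct : (mulᶠ ∘ᶠ (p ∙ᶠ q)) Computes (λ m → g m * h m)
  correct m rewrite eq m | eq′ m = trans (mul-iter _ (h m) (g m) 0) (cong codeℕ (+-identityʳ _))

_^ᶜ_ : ∀ {g h} → ∃ (_Computes g) → ∃ (_Computes h) → ∃ (_Computes (λ m → g m ^ h m))
_^ᶜ_ {g} {h} (p , eq) (q , eq′) = powᶠ ∘ᶠ (p ∙ᶠ q) , correct
  where
  correct : (powᶠ ∘ᶠ (p ∙ᶠ q)) Computes (λ m → g m ^ h m)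
  correct m rewrite eq m | eq′ m = trans (pow-iter _ (g m) (h m) 1) (cong codeℕ (*-identityʳ _))

-- Trees and tree decompositions

∑ : ∀ {A : Set} → List A → (A → ℕ) → ℕ
∑ []       g = 0
∑ (x ∷ xs) g = g x + ∑ xs g

bit : Bool → ℕ
bit false = 0
bit true  = 1

cnt : ∀ {A : Set} → (A → Bool) → List A → ℕ
cnt p xs = ∑ xs (bit ∘ p)

∑-mono : ∀ {A : Set} (xs : List A) {g h : A → ℕ} → (∀ x → g x ≤ h x) → ∑ xs g ≤ ∑ xs h
∑-mono []       le = z≤n
∑-mono (x ∷ xs) le = +-mono-≤ (le x) (∑-mono xs le)

∑-cong : ∀ {A : Set} (xs : List A) {g h : A → ℕ} → (∀ x → g x ≡ h x) → ∑ xs g ≡ ∑ xs h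
∑-cong []       eq = refl
∑-cong (x ∷ xs) eq = cong₂ _+_ (eq x) (∑-cong xs eq)

∑-+ : ∀ {A : Set} (xs : List A) (g h : A → ℕ) → ∑ xs (λ x → g x + h x) ≡ ∑ xs g + ∑ xs h
∑-+ []       g h = refl
∑-+ (x ∷ xs) g h = trans (cong (g x + h x +_) (∑-+ xs g h)) (interchange (g x) (h x) _ _)

∑-zero : ∀ {A : Set} (xs : List A) → ∑ xs (λ _ → 0) ≡ 0
∑-zero []       = refl
∑-zero (x ∷ xs) = ∑-zero xs

∑-swap : ∀ {A B : Set} (xs : List A) (ys : List B) (g : A → B → ℕ) →
         ∑ xs (λ x → ∑ ys (g x)) ≡ ∑ ys (λ y → ∑ xs (λ x → g x y))
∑-swap []       ys g = sym (∑-zero ys)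
∑-swap (x ∷ xs) ys g = trans (cong (∑ ys (g x) +_) (∑-swap xs ys g)) (sym (∑-+ ys (g x) _))

∑≤length* : ∀ {A : Set} (xs : List A) {g : A → ℕ} {c} → (∀ x → g x ≤ c) → ∑ xs g ≤ length xs * c
∑≤length* []       le = z≤n
∑≤length* (x ∷ xs) le = +-mono-≤ (le x) (∑≤length* xs le)

∑-tabulate : ∀ {A : Set} {n} (f : Fin n → A) (g : A → ℕ) → ∑ (tabulate f) g ≡ ∑ (tabulate id) (g ∘ f)
∑-tabulate {n = zero}  f g = refl
∑-tabulate {n = suc n} f g =
  cong (g (f zero) +_) (trans (∑-tabulate (f ∘ suc) g) (sym (∑-tabulate suc (g ∘ f))))

∑-++ : ∀ {A : Set} (xs ys : List A) (g : A → ℕ) → ∑ (xs ++ ys) g ≡ ∑ xs g + ∑ ys g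
∑-++ []       ys g = refl
∑-++ (x ∷ xs) ys g = trans (cong (g x +_) (∑-++ xs ys g)) (sym (+-assoc (g x) _ _))

∑-↭ : ∀ {A : Set} {xs ys : List A} (g : A → ℕ) → xs ↭ ys → ∑ xs g ≡ ∑ ys g
∑-↭ g ↭-refl′        = refl
∑-↭ g (prep x p)     = cong (g x +_) (∑-↭ g p)
∑-↭ g (swap {xs} {ys} x y p) = begin
  g x + (g y + ∑ xs g) ≡⟨ +-assoc (g x) (g y) _ ⟨
  (g x + g y) + ∑ xs g ≡⟨ cong₂ _+_ (+-comm (g x) (g y)) (∑-↭ g p) ⟩
  (g y + g x) + ∑ ys g ≡⟨ +-assoc (g y) (g x) _ ⟩
  g y + (g x + ∑ ys g) ∎
  where open ≡-Reasoning
∑-↭ g (↭-trans′ p q) = trans (∑-↭ g p) (∑-↭ g q)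

unique-++⁻ : ∀ {A : Set} (xs : List A) {ys} → Unique (xs ++ ys) → Unique xs × Unique ys × Disjoint xs ys
unique-++⁻ []       u = [] , u , λ { (() , _) }
unique-++⁻ (x ∷ xs) (x∉ ∷ u) with unique-++⁻ xs u
... | uxs , uys , d = All.tabulate (λ y∈ → All.lookup x∉ (∈-++⁺ˡ y∈)) ∷ uxs , uys , disjoint
  where
  disjoint : Disjoint (x ∷ xs) _
  disjoint (here refl , q) = All.lookup x∉ (∈-++⁺ʳ xs q) refl
  disjoint (there p , q)   = d (p , q)

argmin : ∀ {m} {P : Fin m → Set} → (∀ t → Dec (P t)) → (d : Fin m → ℕ) → ∃ P →
         ∃[ t ] (P t × (∀ s → P s → d t ≤ d s))
argmin {m} {P} P? d (t , pt) = go t pt (<-wellFounded (d t))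
  where
  go : ∀ t → P t → Acc _<_ (d t) → ∃[ t ] (P t × (∀ s → P s → d t ≤ d s))
  go t pt (accessible rec) with any? (λ s → P? s ×-dec (d s <? d t))
  ... | yes (s , ps , lt) = go s ps (rec lt)
  ... | no none           = t , pt , λ s ps → ≮⇒≥ (λ lt → none (s , ps , lt))

module Rooted {m} {Γ : Graph m} (isTree : IsTree Γ) where
  open IsTree isTree

  sym-adj : ∀ {s t} → Adj Γ s t → Adj Γ t s
  sym-adj {s} {t} = subst T (symmetric Γ s t)

  ¬self-adj : ∀ {s} → ¬ Adj Γ s s
  ¬self-adj {s} p = subst T (irreflexive Γ s) p

  Apart : List (Fin m) → List (Fin m) → Set
  Apart (x ∷ _) (y ∷ _) = x ≢ y
  Apart _       _       = ⊤

  -- Path s xs t: the walk s ∷ xs ends in t and never backtracks.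
  data Path : Fin m → List (Fin m) → Fin m → Set where
    stop : ∀ {s} → Path s [] s
    step : ∀ {s t u xs} → Adj Γ s t → Apart xs (s ∷ []) → Path t xs u → Path s (t ∷ xs) u

  path-linked : ∀ {s t} ys {x zs} → Path s (ys ++ x ∷ zs) t → Linked (Adj Γ) (s ∷ ys ++ [ x ])
  path-linked []       (step a _ p) = a ∷ [-]
  path-linked (y ∷ ys) (step a _ p) = a ∷ path-linked ys p

  -- A return to `s` after at least three steps closes a cycle, the vertices in between being
  -- distinct by induction; returns after one or two steps contradict irreflexivity and the absence
  -- of backtracking.
  path-unique : ∀ {s xs t} → Path s xs t → Unique (s ∷ xs)
  path-unique stop = [] ∷ []
  path-unique {s} {xs} p@(step _ _ q) = ¬Any⇒All¬ xs s∉xs ∷ path-unique q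
    where
    s∉xs : s ∉ xs
    s∉xs s∈xs with ∈-∃++ s∈xs
    s∉xs s∈xs | []         , zs , refl with p
    ... | step a _ _ = ¬self-adj a
    s∉xs s∈xs | y ∷ []     , zs , refl with p
    ... | step _ n (step _ _ _) = n refl
    s∉xs s∈xs | y ∷ z ∷ ys , zs , refl = acyclic s (y ∷ z ∷ ys) record
      { atLeast3 = s≤s (s≤s (s≤s z≤n))
      ; distinct = let u , _ , disjoint = unique-++⁻ (y ∷ z ∷ ys) (path-unique q)
                 in ¬Any⇒All¬ _ (λ s∈ → disjoint (s∈ , here refl)) ∷ u
      ; closed   = path-linked (y ∷ z ∷ ys) p
      }

  path-end : ∀ {s c xs t} → Path s (c ∷ xs) t → t ∈ c ∷ xs
  path-end (step _ _ stop)           = here refl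
  path-end (step _ _ p@(step _ _ _)) = there (path-end p)

  ¬closed : ∀ {s c xs} → ¬ Path s (c ∷ xs) s
  ¬closed p with path-unique p
  ... | s∉ ∷ _ = All.lookup s∉ (path-end p) refl

  -- The first walk is reversed onto the second one step at a time, and `Apart` excludes a backtrack
  -- at the common start. The length is recorded in order to know that the result is nonempty.
  join : ∀ {s xs t ys u} → Path s xs t → Path s ys u → Apart xs ys →
         ∃[ zs ] (Path t zs u × length zs ≡ length xs + length ys)
  join stop q _ = _ , q , refl
  join {ys = ys} (step {s} {c} {xs = xs} a n p) q apart
    with join p (step (sym-adj a) (apart-sym apart) q) (apart-cons xs n)
    where
    apart-cons : ∀ xs → Apart xs (s ∷ []) → Apart xs (s ∷ ys)
    apart-cons []      _ = tt
    apart-cons (_ ∷ _) n = n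
    apart-sym : ∀ {ys} → Apart (c ∷ xs) ys → Apart ys (c ∷ [])
    apart-sym {[]}    _ = tt
    apart-sym {_ ∷ _} n = n ∘ sym
  ... | zs , r , eq = zs , r , trans eq (+-suc (length xs) (length ys))

  -- Where two such walks first part, joining what remains of them would give a closed nonempty one.
  paths-equal : ∀ {s xs ys t} → Path s xs t → Path s ys t → xs ≡ ys
  paths-equal stop           stop           = refl
  paths-equal stop           q@(step _ _ _) = ⊥-elim (¬closed q)
  paths-equal p@(step _ _ _) stop           = ⊥-elim (¬closed p)
  paths-equal p@(step {t = c} _ _ p′) q@(step {t = d} _ _ q′) with c ≟ d
  ... | yes refl = cong (c ∷_) (paths-equal p′ q′)
  ... | no c≢d with join p q c≢d
  ...   | _ ∷ _ , r , _ = ⊥-elim (¬closed r)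

  -- A new first step either cancels the next step, when that leads straight back, or extends the
  -- walk.
  path : ∀ {s t} → Star (Adj Γ) s t → ∃[ xs ] Path s xs t
  path ε = [] , stop
  path {s} (a ◅ as) with path as
  ... | [] , stop = _ , step a tt stop
  ... | c ∷ xs , p@(step _ _ q) with c ≟ s
  ...   | yes refl = xs , q
  ...   | no c≢s   = _ , step a c≢s p

  root : Fin m
  root = first nonempty
    where
    first : ∀ {m} → NonZero m → Fin m
    first {suc m} _ = zero

  up : Fin m → List (Fin m)
  up s = proj₁ (path (connected s root))

  up-path : ∀ s → Path s (up s) root
  up-path s = proj₂ (path (connected s root))

  up-unique : ∀ {s xs} → Path s xs root → xs ≡ up s
  up-unique p = paths-equal p (up-path _)

  depth : Fin m → ℕ
  depth = length ∘ up

  _above_ : Fin m → Fin m → Set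
  a above s = a ∈ s ∷ up s

  parent : ∀ {s t} → Adj Γ s t → up s ≡ t ∷ up t ⊎ up t ≡ s ∷ up s
  parent {s} {t} a with up s | up-path s
  ... | []     | p = inj₂ (sym (up-unique (step (sym-adj a) tt p)))
  ... | c ∷ xs | p@(step _ _ q) with c ≟ t
  ...   | yes refl = inj₁ (cong (c ∷_) (up-unique q))
  ...   | no c≢t   = inj₂ (sym (up-unique (step (sym-adj a) c≢t p)))

  comparable : ∀ {s xs a b} → Path s xs root → a ∈ s ∷ xs → b ∈ s ∷ xs → a above b ⊎ b above a
  comparable p (here refl) b∈ = inj₂ (subst (λ xs → _ ∈ _ ∷ xs) (up-unique p) b∈)
  comparable p (there a∈) (here refl) = inj₁ (subst (λ xs → _ ∈ _ ∷ xs) (up-unique p) (there a∈))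
  comparable (step _ _ p) (there a∈) (there b∈) = comparable p a∈ b∈

  depth-decreases : ∀ {s xs a} → Path s xs root → a ∈ xs → depth a < length xs
  depth-decreases (step _ _ p) (here refl) = s≤s (≤-reflexive (cong length (sym (up-unique p))))
  depth-decreases (step _ _ p) (there a∈)  = m<n⇒m<1+n (depth-decreases p a∈)

  above-antisym : ∀ {a b} → a above b → b above a → a ≡ b
  above-antisym (here eq)  _          = eq
  above-antisym (there _)  (here eq)  = sym eq
  above-antisym {a} {b} (there a∈) (there b∈) =
    ⊥-elim (<-asym (depth-decreases (up-path b) a∈) (depth-decreases (up-path a) b∈))

module Orientation {n} {G : Graph n} (D : TreeDecomposition G) where
  open TreeDecomposition D
  open Rooted isTree

  topmost : ∀ v → ∃[ t ] (v ∈ˢ bag t × (∀ s → v ∈ˢ bag s → depth t ≤ depth s))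
  topmost v = argmin (λ t → v ∈ˢ? bag t) depth (vertexIn v)

  top : Fin n → Fin nodes
  top v = proj₁ (topmost v)

  above-step : ∀ {a s t} → Adj tree s t → a above s → a ≢ s → a above t
  above-step a (here eq)  a≢s = ⊥-elim (a≢s eq)
  above-step a (there a∈) a≢s with parent a
  ... | inj₁ eq = subst (_ ∈_) eq a∈
  ... | inj₂ eq = there (subst (_ ∈_) (sym eq) (there a∈))

  -- A walk through bags of `v` could leave the subtree below `top v` only through the parent of
  -- `top v`, which would be a node of smaller depth whose bag contains `v`.
  top-above : ∀ v {s t} → Star (InBags v) s t → top v above s → top v above t
  top-above v ε h = h
  top-above v {s} ((a , s∈ , t∈) ◅ rest) h = top-above v rest (next h)
    where
    next : top v above s → top v above _
    next h with parent a | h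
    ... | inj₁ eq | there p   = subst (top v ∈_) eq p
    ... | inj₂ eq | q         = there (subst (top v ∈_) (sym eq) q)
    ... | inj₁ eq | here refl =
      ⊥-elim (<⇒≱ (subst (λ xs → _ < length xs) (sym eq) ≤-refl) (proj₂ (proj₂ (topmost v)) _ t∈))

  -- The walk from `s` to `top u` starts below `top v` and ends above it, so it passes through
  -- `top v`; all its bags contain `u`.
  in-top-bag : ∀ u v {s} → u ∈ˢ bag s → Star (InBags u) s (top u) → top v above s → top u above top v →
               u ∈ˢ bag (top v)
  in-top-bag u v u∈ ε h h′ = subst (λ t → u ∈ˢ bag t) (above-antisym h′ h) u∈
  in-top-bag u v {s} u∈ ((a , _ , u∈′) ◅ rest) h h′ with top v ≟ s
  ... | yes eq = subst (λ t → u ∈ˢ bag t) (sym eq) u∈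
  ... | no ≢s  = in-top-bag u v u∈′ rest (above-step a h ≢s) h′

  -- Orienting each edge this way bounds the out-degrees by the bag sizes.
  edge-in-top-bag : ∀ u v → Adj G u v → u ∈ˢ bag (top v) ⊎ v ∈ˢ bag (top u)
  edge-in-top-bag u v a with edgeIn u v a
  ... | s , u∈ , v∈ = helper (comparable (up-path s) (above-s u u∈) (above-s v v∈))
    where
    above-s : ∀ x → x ∈ˢ bag s → top x above s
    above-s x x∈ = top-above x (coherent x (top x) s (proj₁ (proj₂ (topmost x))) x∈) (here refl)
    to-top : ∀ x → x ∈ˢ bag s → Star (InBags x) s (top x)
    to-top x x∈ = coherent x s (top x) x∈ (proj₁ (proj₂ (topmost x)))
    helper : top u above top v ⊎ top v above top u → u ∈ˢ bag (top v) ⊎ v ∈ˢ bag (top u)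
    helper (inj₁ p) = inj₁ (in-top-bag u v u∈ (to-top u u∈) (above-s v v∈) p)
    helper (inj₂ p) = inj₂ (in-top-bag v u v∈ (to-top v v∈) (above-s u u∈) p)

deg : ∀ {n} → Graph n → Fin n → ℕ
deg {n} G u = cnt (adj G u) (allFin n)

high : ∀ {n} → Graph n → Fin n → Bool
high {n} G u = n ≤ᵇ deg G u + deg G u

cnt-subset : ∀ {n} (p : Subset n) → cnt (Vec.lookup p) (allFin n) ≡ ∣ p ∣
cnt-subset [] = refl
cnt-subset (true ∷ p)  = cong suc (trans (∑-tabulate Fin.suc (bit ∘ Vec.lookup (true ∷ p))) (cnt-subset p))
cnt-subset (false ∷ p) = trans (∑-tabulate Fin.suc (bit ∘ Vec.lookup (false ∷ p))) (cnt-subset p)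

-- Each ordered adjacent pair is charged, in one of its two orders, to a membership in a top bag.
-- There are at most `n * suc w` such memberships, and each is charged at most twice.
degree-sum : ∀ {n} (G : Graph n) w → TreeWidthAtMost G w →
             ∑ (allFin n) (deg G) ≤ 2 * (n * suc w)
degree-sum {n} G w (D , width) = begin
  ∑ V (λ u → ∑ V (λ v → bit (adj G u v)))                            ≤⟨ ∑-mono V (λ u → ∑-mono V (pointwise u)) ⟩
  ∑ V (λ u → ∑ V (λ v → within u v + within v u))                    ≡⟨ ∑-cong V (λ u → ∑-+ V (within u) (λ v → within v u)) ⟩
  ∑ V (λ u → ∑ V (within u) + ∑ V (λ v → within v u))                ≡⟨ ∑-+ V _ _ ⟩
  ∑ V (λ u → ∑ V (within u)) + ∑ V (λ u → ∑ V (λ v → within v u))    ≡⟨ cong (_+ ∑ V (λ u → ∑ V (λ v → within v u))) (∑-swap V V within) ⟩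
  ∑ V (λ u → ∑ V (λ v → within v u)) + ∑ V (λ u → ∑ V (λ v → within v u)) ≤⟨ +-mono-≤ total total ⟩
  n * suc w + n * suc w                                              ≡⟨ cong (n * suc w +_) (+-identityʳ _) ⟨
  2 * (n * suc w)                                                    ∎
  where
  open ≤-Reasoning
  open TreeDecomposition D using (bag)
  open Orientation D
  V = allFin n
  within : Fin n → Fin n → ℕ
  within u v = bit (Vec.lookup (bag (top v)) u)
  pointwise : ∀ u v → bit (adj G u v) ≤ within u v + within v u
  pointwise u v with adj G u v | edge-in-top-bag u v
  ... | false | _ = z≤n
  ... | true  | f with f tt
  ...   | inj₁ p rewrite []=⇒lookup p = s≤s z≤n
  ...   | inj₂ p rewrite []=⇒lookup p = m≤n+m 1 _
  total : ∑ V (λ u → ∑ V (λ v → within v u)) ≤ n * suc w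
  total = ≤-trans (∑≤length* V (λ u → ≤-trans (≤-reflexive (cnt-subset (bag (top u)))) (width (top u))))
                  (≤-reflexive (cong (_* suc w) (length-tabulate {n = n} id)))

few-high : ∀ {n} (G : Graph n) w → TreeWidthAtMost G w → cnt (high G) (allFin n) ≤ 4 * suc w
few-high {zero} G w tw = z≤n
few-high n@{suc _} G w tw = *-cancelʳ-≤ _ _ n (begin
  cnt (high G) V * n                    ≡⟨ ∑-scale V ⟩
  ∑ V (λ u → bit (high G u) * n)        ≤⟨ ∑-mono V pointwise ⟩
  ∑ V (λ u → deg G u + deg G u)         ≡⟨ ∑-+ V (deg G) (deg G) ⟩
  ∑ V (deg G) + ∑ V (deg G)             ≤⟨ +-mono-≤ (degree-sum G w tw) (degree-sum G w tw) ⟩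
  2 * (n * suc w) + 2 * (n * suc w)     ≡⟨ *-distribʳ-+ (n * suc w) 2 2 ⟨
  4 * (n * suc w)                       ≡⟨ cong (4 *_) (*-comm n (suc w)) ⟩
  4 * (suc w * n)                       ≡⟨ *-assoc 4 (suc w) n ⟨
  4 * suc w * n                         ∎)
  where
  open ≤-Reasoning
  V = allFin n
  ∑-scale : ∀ xs → cnt (high G) xs * n ≡ ∑ xs (λ u → bit (high G u) * n)
  ∑-scale []       = refl
  ∑-scale (x ∷ xs) = trans (*-distribʳ-+ n (bit (high G x)) _) (cong (_ +_) (∑-scale xs))
  pointwise : ∀ u → bit (high G u) * n ≤ deg G u + deg G u
  pointwise u with high G u in eq
  ... | false = z≤n
  ... | true  = ≤-trans (≤-reflexive (*-identityˡ n)) (≤ᵇ⇒≤ n _ (subst T (sym eq) tt))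

-- Path covers of the complement and the Bondy–Chvátal closure

module _ {A : Set} (bad : A → A → Bool) where

  -- Both lists are read away from the point where they meet, as in `xs ʳ++ ys`; this is how
  -- orderings are split at a pair below.
  junction : List A → List A → ℕ
  junction (x ∷ _) (y ∷ _) = bit (bad x y)
  junction _       _       = 0

  breaks : List A → ℕ
  breaks []       = 0
  breaks (x ∷ xs) = junction (x ∷ []) xs + breaks xs

Arrangeable : ∀ {A : Set} → (A → A → Bool) → List A → ℕ → Set
Arrangeable bad xs k = ∃[ σ ] (σ ↭ xs × breaks bad σ < k)

module _ {A : Set} {bad : A → A → Bool} where

  breaks-++ : ∀ xs ys → breaks bad (xs ++ ys) ≤ breaks bad xs + suc (breaks bad ys)
  breaks-++ []       ys = n≤1+n _
  breaks-++ (x ∷ []) ys = +-mono-≤ (junction≤1 ys) (≤-refl {breaks bad ys})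
    where
    junction≤1 : ∀ ys → junction bad (x ∷ []) ys ≤ 1
    junction≤1 [] = z≤n
    junction≤1 (y ∷ ys) with bad x y
    ... | false = z≤n
    ... | true  = ≤-refl
  breaks-++ (x ∷ y ∷ xs) ys =
    ≤-trans (+-monoʳ-≤ (bit (bad x y)) (breaks-++ (y ∷ xs) ys))
            (≤-reflexive (sym (+-assoc (bit (bad x y)) (breaks bad (y ∷ xs)) _)))

  breaks-mid : ∀ xs {x} ys → breaks bad (xs ++ x ∷ ys) ≡ breaks bad (xs ++ x ∷ []) + breaks bad (x ∷ ys)
  breaks-mid []           ys = refl
  breaks-mid (y ∷ [])     {x} ys =
    sym (cong (_+ breaks bad (x ∷ ys)) (+-identityʳ (bit (bad y x))))
  breaks-mid (y ∷ z ∷ xs) ys =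
    trans (cong (bit (bad y z) +_) (breaks-mid (z ∷ xs) ys)) (sym (+-assoc (bit (bad y z)) _ _))

  Good : List A → Set
  Good = Linked (λ x y → bad x y ≡ false)

  good⇒breaks : ∀ {xs} → Good xs → breaks bad xs ≡ 0
  good⇒breaks []       = refl
  good⇒breaks [-]      = refl
  good⇒breaks (p ∷ ps) = cong₂ _+_ (cong bit p) (good⇒breaks ps)

  breaks-concat : ∀ p ps → All Good (p ∷ ps) → breaks bad (concat (p ∷ ps)) ≤ length ps
  breaks-concat p [] (g ∷ []) = ≤-reflexive (trans (cong (breaks bad) (++-identityʳ p)) (good⇒breaks g))
  breaks-concat p (q ∷ qs) (g ∷ gs) = begin
    breaks bad (p ++ concat (q ∷ qs))                     ≤⟨ breaks-++ p _ ⟩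
    breaks bad p + suc (breaks bad (concat (q ∷ qs)))     ≡⟨ cong (_+ _) (good⇒breaks g) ⟩
    suc (breaks bad (concat (q ∷ qs)))                    ≤⟨ s≤s (breaks-concat q qs gs) ⟩
    suc (length qs)                                       ∎
    where open ≤-Reasoning

  pieces : ∀ x xs → ∃[ p ] ∃[ ps ] (concat ((x ∷ p) ∷ ps) ≡ x ∷ xs × All Good ((x ∷ p) ∷ ps) ×
                                     All (_≢ []) ps × length ps ≡ breaks bad (x ∷ xs))
  pieces x [] = [] , [] , refl , [-] ∷ [] , [] , refl
  pieces x (y ∷ xs) with pieces y xs | bad x y in eq
  ... | p , ps , c , gs , ne , l | true  =
    [] , (y ∷ p) ∷ ps , cong (x ∷_) c , [-] ∷ gs , (λ ()) ∷ ne , cong suc l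
  ... | p , ps , c , g ∷ gs , ne , l | false =
    y ∷ p , ps , cong (x ∷_) c , (eq ∷ g) ∷ gs , ne , l

  module _ (symmetric : ∀ x y → bad x y ≡ bad y x) where

    junction-sym : ∀ xs ys → junction bad xs ys ≡ junction bad ys xs
    junction-sym []      []      = refl
    junction-sym []      (_ ∷ _) = refl
    junction-sym (_ ∷ _) []      = refl
    junction-sym (x ∷ _) (y ∷ _) = cong bit (symmetric x y)

    junction-head : ∀ x {xs} ys → junction bad (x ∷ xs) ys ≡ junction bad (x ∷ []) ys
    junction-head x []      = refl
    junction-head x (_ ∷ _) = refl

    breaks-ʳ++ : ∀ xs ys → breaks bad (xs ʳ++ ys) ≡ (breaks bad xs + breaks bad ys) + junction bad xs ys
    breaks-ʳ++ []       ys = sym (+-identityʳ _)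
    breaks-ʳ++ (x ∷ xs) ys = begin
      breaks bad (xs ʳ++ x ∷ ys)                        ≡⟨ breaks-ʳ++ xs (x ∷ ys) ⟩
      (b + (j + c)) + junction bad xs (x ∷ ys)          ≡⟨ cong ((b + (j + c)) +_) (trans (junction-sym xs (x ∷ ys)) (junction-head x xs)) ⟩
      (b + (j + c)) + i                                 ≡⟨ cong (λ z → (b + z) + i) (+-comm j c) ⟩
      (b + (c + j)) + i                                 ≡⟨ cong (_+ i) (+-assoc b c j) ⟨
      ((b + c) + j) + i                                 ≡⟨ +-comm _ i ⟩
      i + ((b + c) + j)                                 ≡⟨ +-assoc i (b + c) j ⟨
      (i + (b + c)) + j                                 ≡⟨ cong (_+ j) (+-assoc i b c) ⟨
      ((i + b) + c) + j                                 ≡⟨ cong (((i + b) + c) +_) (junction-head x ys) ⟨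
      ((i + b) + c) + junction bad (x ∷ xs) ys          ∎
      where
      open ≡-Reasoning
      b = breaks bad xs
      c = breaks bad ys
      j = junction bad (x ∷ []) ys
      i = junction bad (x ∷ []) xs

    -- The two sides are reversals of each other. Thereby a rotation behind `v` can be treated as
    -- one in front of `u`.
    breaks-ʳ++-comm : ∀ xs ys → breaks bad (xs ʳ++ ys) ≡ breaks bad (ys ʳ++ xs)
    breaks-ʳ++-comm xs ys = trans (breaks-ʳ++ xs ys) (trans
      (cong₂ _+_ (+-comm (breaks bad xs) (breaks bad ys)) (junction-sym xs ys)) (sym (breaks-ʳ++ ys xs)))

    -- The segment from b to u, which precedes v, is reversed.
    breaks-rotate : ∀ {u v b} P S B A → B ++ b ∷ A ≡ u ∷ P →
                    junction bad (u ∷ []) A ≡ 0 → bad v b ≡ false →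
                    breaks bad (A ʳ++ (B ++ b ∷ v ∷ S)) + bit (bad u v) ≤ breaks bad ((u ∷ P) ʳ++ (v ∷ S))
    breaks-rotate {u} {v} {b} P S B A split j≡0 vb = begin
      breaks bad (A ʳ++ (B ++ b ∷ R)) + d                           ≡⟨ cong (_+ d) (breaks-ʳ++ A _) ⟩
      ((a + breaks bad (B ++ b ∷ R)) + junction bad A (B ++ b ∷ R)) + d ≡⟨ cong (λ z → ((a + breaks bad (B ++ b ∷ R)) + z) + d) head≡u ⟩
      ((a + breaks bad (B ++ b ∷ R)) + 0) + d                       ≡⟨ cong (_+ d) (+-identityʳ _) ⟩
      (a + breaks bad (B ++ b ∷ R)) + d                             ≡⟨ cong (λ z → (a + z) + d) (breaks-mid B R) ⟩
      (a + (β + (bit (bad b v) + breaks bad R))) + d                ≡⟨ cong (λ z → (a + (β + (bit z + breaks bad R))) + d) (trans (symmetric b v) vb) ⟩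
      (a + (β + breaks bad R)) + d                                  ≡⟨ cong (_+ d) (+-assoc a β _) ⟨
      ((a + β) + breaks bad R) + d                                  ≤⟨ +-monoˡ-≤ d (+-monoˡ-≤ (breaks bad R) segment) ⟩
      (breaks bad (B ++ b ∷ A) + breaks bad R) + d                  ≡⟨ cong (λ z → (breaks bad z + breaks bad R) + d) split ⟩
      (breaks bad (u ∷ P) + breaks bad R) + d                       ≡⟨ breaks-ʳ++ (u ∷ P) R ⟨
      breaks bad ((u ∷ P) ʳ++ R)                                    ∎
      where
      open ≤-Reasoning
      R = v ∷ S
      a = breaks bad A
      β = breaks bad (B ++ b ∷ [])
      d = bit (bad u v)
      head-junction : ∀ B {P} → B ++ b ∷ A ≡ u ∷ P → junction bad A (B ++ b ∷ R) ≡ junction bad (u ∷ []) A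
      head-junction []      refl = trans (junction-sym A (b ∷ R)) (junction-head b A)
      head-junction (_ ∷ B) refl = trans (junction-sym A (u ∷ B ++ b ∷ R)) (junction-head u A)
      head≡u : junction bad A (B ++ b ∷ R) ≡ 0
      head≡u = trans (head-junction B split) j≡0
      -- `b` and the head of `A` are no longer consecutive; a break between them is given up, which
      -- only helps.
      segment : a + β ≤ breaks bad (B ++ b ∷ A)
      segment = begin
        a + β                                          ≡⟨ +-comm a β ⟩
        β + a                                          ≤⟨ +-monoʳ-≤ β (m≤n+m a (junction bad (b ∷ []) A)) ⟩
        β + breaks bad (b ∷ A)                         ≡⟨ breaks-mid B A ⟨
        breaks bad (B ++ b ∷ A)                        ∎

breaks-mono : ∀ {A : Set} {bad bad′ : A → A → Bool} → (∀ x y → bit (bad x y) ≤ bit (bad′ x y)) →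
              ∀ xs → breaks bad xs ≤ breaks bad′ xs
breaks-mono le []           = z≤n
breaks-mono le (x ∷ [])     = z≤n
breaks-mono le (x ∷ y ∷ xs) = +-mono-≤ (le x y) (breaks-mono le (y ∷ xs))

-- Some consecutive pair must count for `bad′` and not for `bad`. The scanned prefix is carried
-- reversed, so that the pair comes out in the form that the rotation takes.
fewer-breaks : ∀ {A : Set} {bad bad′ : A → A → Bool} xs x σ → breaks bad (x ∷ σ) < breaks bad′ (x ∷ σ) →
               ∃[ u ] ∃[ P ] ∃[ v ] ∃[ S ]
                 ((u ∷ P) ʳ++ (v ∷ S) ≡ xs ʳ++ x ∷ σ × bad′ u v ≡ true × bad u v ≡ false)
fewer-breaks xs x [] ()
fewer-breaks {bad = bad} {bad′} xs x (y ∷ σ) lt with bad x y in eq₁ | bad′ x y in eq₂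
... | false | true  = x , xs , y , σ , refl , eq₂ , eq₁
... | false | false = fewer-breaks (x ∷ xs) y σ lt
... | true  | true  = fewer-breaks (x ∷ xs) y σ (s≤s⁻¹ lt)
... | true  | false = fewer-breaks (x ∷ xs) y σ (<-trans (n<1+n _) lt)

↭-ʳ++ : ∀ {A : Set} (xs ys : List A) → xs ʳ++ ys ↭ xs ++ ys
↭-ʳ++ []       ys = ↭-refl
↭-ʳ++ (x ∷ xs) ys = ↭-trans (↭-ʳ++ xs (x ∷ ys)) (shift x xs ys)

unique-concat⁻ : ∀ {A : Set} (ps : List (List A)) → Unique (concat ps) → All Unique ps × AllPairs Disjoint ps
unique-concat⁻ []       u = [] , []
unique-concat⁻ (p ∷ ps) u with unique-++⁻ p u
... | up , ups , d with unique-concat⁻ ps ups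
...   | us , ds = up ∷ us , All.tabulate (λ q∈ (x∈p , x∈q) → d (x∈p , ∈-concat⁺′ x∈q q∈)) ∷ ds

unique-resp-↭ : ∀ {A : Set} {xs ys : List A} → xs ↭ ys → Unique xs → Unique ys
unique-resp-↭ {A} p = Permutationₛ.Unique-resp-↭ (setoid A) (↭⇒↭ₛ p)

module _ {n} (G : Graph n) where

  linked⇒good : ∀ {xs} → Linked (Adj (complement G)) xs → Good {bad = adj G} xs
  linked⇒good []       = []
  linked⇒good [-]      = [-]
  linked⇒good (_∷_ {x} {y} p ps) = nonadjacent p ∷ linked⇒good ps
    where
    nonadjacent : Adj (complement G) x y → adj G x y ≡ false
    nonadjacent p with does (x ≟ y) | adj G x y
    ... | false | false = refl

  good⇒linked : ∀ {xs} → Unique xs → Good {bad = adj G} xs → Linked (Adj (complement G)) xs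
  good⇒linked u [] = []
  good⇒linked u [-] = [-]
  good⇒linked ((x≢y ∷ _) ∷ u) (_∷_ {x} {y} p ps) = adjacent ∷ good⇒linked u ps
    where
    adjacent : Adj (complement G) x y
    adjacent rewrite p with x ≟ y
    ... | yes eq = x≢y eq
    ... | no _   = tt

  cover⇒arrangeable : ∀ {k} → NonZero k → PathCover (complement G) k → Arrangeable (adj G) (allFin n) k
  cover⇒arrangeable {k} k≢0 C = concat paths , perm , few paths atMost (All.map (linked⇒good ∘ IsPath.linked) arePaths)
    where
    open PathCover C
    perm : concat paths ↭ allFin n
    perm = ∼bag⇒↭ (unique∧set⇒bag (concat⁺ (All.map IsPath.distinct arePaths) disjoint) (allFin⁺ n)
             (mk⇔ (λ _ → ∈-allFin _) (λ _ → ∈-concat⁺ (covers _))))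
    few : ∀ ps → length ps ≤ k → All (Good {bad = adj G}) ps → breaks (adj G) (concat ps) < k
    -- The empty cover has 0 breaks, and `k` is positive.
    few []       le gs = >-nonZero⁻¹ k {{k≢0}}
    few (p ∷ ps) le gs = ≤-trans (s≤s (breaks-concat p ps gs)) le

  arrangeable⇒cover : ∀ {k} → Arrangeable (adj G) (allFin n) k → PathCover (complement G) k
  -- Paths are nonempty, so the empty ordering yields no path at all.
  arrangeable⇒cover ([] , perm , _) = record
    { paths = [] ; atMost = z≤n ; arePaths = [] ; disjoint = []
    ; covers = λ v → ⊥-elim (¬∈[] (∈-resp-↭ (↭-sym perm) (∈-allFin v))) }
    where
    ¬∈[] : ∀ {v : Fin n} → v ∉ []
    ¬∈[] ()
  arrangeable⇒cover {k} (x ∷ xs , perm , lt) with pieces {bad = adj G} x xs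
  ... | p , ps , eq , gs , ne , l with unique-concat⁻ ((x ∷ p) ∷ ps) (subst Unique (sym eq) unique)
    where
    unique : Unique (x ∷ xs)
    unique = unique-resp-↭ (↭-sym perm) (allFin⁺ n)
  ...   | us , ds = record
    { paths    = (x ∷ p) ∷ ps
    ; atMost   = subst (_< k) (sym l) lt
    ; arePaths = All.zipWith (λ (ne , u , g) → record { nonempty = ne ; distinct = u ; linked = good⇒linked u g })
                   ((λ ()) ∷ ne , All.zip (us , gs))
    ; disjoint = ds
    ; covers   = λ v → ∈-concat⁻ ((x ∷ p) ∷ ps) (subst (v ∈_) (sym eq) (∈-resp-↭ (↭-sym perm) (∈-allFin v)))
    }

module Closure {n} (G : Graph n) where

  -- The adjacent pairs left out, those with both ends low, are the ones that the closure joins in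
  -- the complement.
  bad : Fin n → Fin n → Bool
  bad u v = (high G u ∨ high G v) ∧ adj G u v

  bad-sym : ∀ u v → bad u v ≡ bad v u
  bad-sym u v = cong₂ _∧_ (∨-comm (high G u) (high G v)) (symmetric G u v)

  bad≤adj : ∀ u v → bit (bad u v) ≤ bit (adj G u v)
  bad≤adj u v with high G u ∨ high G v
  ... | false = z≤n
  ... | true  = ≤-refl

  low-pair : ∀ u v → adj G u v ≡ true → bad u v ≡ false → high G u ≡ false × high G v ≡ false
  low-pair u v p q with high G u | high G v | adj G u v
  ... | false | false | _ = refl , refl
  low-pair u v () q | true  | _    | false
  low-pair u v p () | true  | _    | true
  low-pair u v () q | false | true | false
  low-pair u v p () | false | true | true

  low⇒< : ∀ u → high G u ≡ false → deg G u + deg G u < n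
  low⇒< u eq = ≰⇒> (λ le → subst T eq (≤⇒≤ᵇ le))

  -- A place where the rotation creates no new break. The list `b₀ ∷ A₀` is the side of `u`, read
  -- away from `v`; `b₀` is `u` itself in `rotate` and arbitrary for the induction.
  Pivot : Fin n → Fin n → Fin n → List (Fin n) → Set
  Pivot u v b₀ A₀ = ∃[ B ] ∃[ b ] ∃[ A ] (B ++ b ∷ A ≡ b₀ ∷ A₀ × junction (adj G) (u ∷ []) A ≡ 0 × adj G v b ≡ false)

  -- Without a pivot, every member of the list is a neighbour of `v` or is followed by a neighbour
  -- of `u`, and the last one is a neighbour of `v`. This is the counting in Ore's theorem.
  pivot : ∀ u v b A → Pivot u v b A ⊎ length (b ∷ A) ≤ cnt (adj G u) A + cnt (adj G v) (b ∷ A)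
  pivot u v b [] with adj G v b in eq
  ... | false = inj₁ ([] , b , [] , refl , refl , eq)
  ... | true  = inj₂ ≤-refl
  pivot u v b (a ∷ A) with adj G u a in eq₁ | adj G v b in eq₂ | pivot u v a A
  ... | false | false | _ = inj₁ ([] , b , a ∷ A , refl , cong bit eq₁ , eq₂)
  ... | false | true  | inj₁ (B , c , C , eq , p) = inj₁ (b ∷ B , c , C , cong (b ∷_) eq , p)
  ... | true  | _     | inj₁ (B , c , C , eq , p) = inj₁ (b ∷ B , c , C , cong (b ∷_) eq , p)
  ... | true  | y     | inj₂ le = inj₂ (s≤s (≤-trans le (+-monoʳ-≤ (cnt (adj G u) A) (m≤n+m _ (bit y)))))
  ... | false | true  | inj₂ le = inj₂ (≤-trans (s≤s le) (≤-reflexive (sym (+-suc (cnt (adj G u) A) _))))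

  ↭-rotate : ∀ {b : Fin n} {L} B A R → B ++ b ∷ A ≡ L → A ʳ++ (B ++ b ∷ R) ↭ L ʳ++ R
  ↭-rotate {b} {L} B A R refl = begin
    A ʳ++ (B ++ b ∷ R)       ↭⟨ ↭-ʳ++ A _ ⟩
    A ++ (B ++ b ∷ R)        ≡⟨ cong (A ++_) (sym (++ₗ-assoc B (b ∷ []) R)) ⟩
    A ++ ((B ++ b ∷ []) ++ R) ≡⟨ ++ₗ-assoc A (B ++ b ∷ []) R ⟨
    (A ++ (B ++ b ∷ [])) ++ R ↭⟨ ++⁺ʳ R (++-comm A (B ++ b ∷ [])) ⟩
    ((B ++ b ∷ []) ++ A) ++ R ≡⟨ cong (_++ R) (++ₗ-assoc B (b ∷ []) A) ⟩
    (B ++ b ∷ A) ++ R        ↭⟨ ↭-ʳ++ (B ++ b ∷ A) R ⟨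
    (B ++ b ∷ A) ʳ++ R       ∎
    where open PermutationReasoning

  Improves : List (Fin n) → List (Fin n) → Set
  Improves σ τ = τ ↭ σ × breaks (adj G) τ < breaks (adj G) σ × breaks bad τ ≤ breaks bad σ

  rotate : ∀ u P v S → adj G u v ≡ true → Pivot u v u P → ∃[ τ ] Improves ((u ∷ P) ʳ++ (v ∷ S)) τ
  rotate u P v S uv (B , b , A , split , j , vb) = A ʳ++ (B ++ b ∷ v ∷ S) , ↭-rotate B A (v ∷ S) split ,
    ≤-trans (≤-reflexive (trans (+-comm 1 _) (cong (λ z → breaks (adj G) (A ʳ++ (B ++ b ∷ v ∷ S)) + bit z) (sym uv))))
            (breaks-rotate (symmetric G) P S B A split j vb) ,
    ≤-trans (m≤m+n _ (bit (bad u v))) (breaks-rotate bad-sym P S B A split (bad-junction A j) bad-vb)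
    where
    bad-junction : ∀ A → junction (adj G) (u ∷ []) A ≡ 0 → junction bad (u ∷ []) A ≡ 0
    bad-junction []      _ = refl
    bad-junction (a ∷ _) j = n≤0⇒n≡0 (subst (bit (bad u a) ≤_) j (bad≤adj u a))
    bad-vb : bad v b ≡ false
    bad-vb rewrite vb = ∧-zeroʳ _

  -- If neither side has a pivot, the two counts add up to `n ≤ deg G u + deg G v`, whereas both
  -- vertices are low.
  improve : ∀ u P v S → (u ∷ P) ʳ++ (v ∷ S) ↭ allFin n → adj G u v ≡ true → bad u v ≡ false →
            ∃[ τ ] Improves ((u ∷ P) ʳ++ (v ∷ S)) τ
  improve u P v S perm uv ¬bad with pivot u v u P | pivot v u v S
  ... | inj₁ p  | _ = rotate u P v S uv p
  ... | inj₂ _  | inj₁ p with rotate v S u P (trans (symmetric G v u) uv) p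
  ...   | τ , perm′ , lt , le = τ , ↭-trans perm′ flip ,
          subst (_ <_) (breaks-ʳ++-comm (symmetric G) (v ∷ S) (u ∷ P)) lt ,
          subst (_ ≤_) (breaks-ʳ++-comm bad-sym (v ∷ S) (u ∷ P)) le
    where
    flip : (v ∷ S) ʳ++ (u ∷ P) ↭ (u ∷ P) ʳ++ (v ∷ S)
    flip = ↭-trans (↭-ʳ++ (v ∷ S) _) (↭-trans (++-comm (v ∷ S) (u ∷ P)) (↭-sym (↭-ʳ++ (u ∷ P) _)))
  improve u P v S perm uv ¬bad | inj₂ le | inj₂ le′ = ⊥-elim (<-irrefl refl (begin-strict
    n + n                                  ≤⟨ +-mono-≤ size size ⟩
    (deg G u + deg G v) + (deg G u + deg G v) ≡⟨ interchange (deg G u) (deg G v) (deg G u) (deg G v) ⟩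
    (deg G u + deg G u) + (deg G v + deg G v) <⟨ +-mono-< (low⇒< u (proj₁ low)) (low⇒< v (proj₂ low)) ⟩
    n + n                                  ∎))
    where
    open ≤-Reasoning
    low = low-pair u v uv ¬bad
    perm′ : (u ∷ P) ++ (v ∷ S) ↭ allFin n
    perm′ = ↭-trans (↭-sym (↭-ʳ++ (u ∷ P) _)) perm
    split : ∀ g → ∑ (u ∷ P) g + ∑ (v ∷ S) g ≡ ∑ (allFin n) g
    split g = trans (sym (∑-++ (u ∷ P) (v ∷ S) g)) (∑-↭ g perm′)
    length≡ : length (u ∷ P) + length (v ∷ S) ≡ n
    length≡ = trans (sym (length-++ (u ∷ P)))
      (trans (↭-length perm′) (length-tabulate id))
    size : n ≤ deg G u + deg G v
    size = begin
      n                                   ≡⟨ length≡ ⟨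
      length (u ∷ P) + length (v ∷ S)     ≤⟨ +-mono-≤ le le′ ⟩
      (cu P + cv (u ∷ P)) + (cv S + cu (v ∷ S)) ≡⟨ cong ((cu P + cv (u ∷ P)) +_) (+-comm (cv S) _) ⟩
      (cu P + cv (u ∷ P)) + (cu (v ∷ S) + cv S) ≡⟨ interchange (cu P) _ _ _ ⟩
      (cu P + cu (v ∷ S)) + (cv (u ∷ P) + cv S) ≤⟨ +-mono-≤ (+-monoˡ-≤ (cu (v ∷ S)) (m≤n+m (cu P) (bit (adj G u u))))
                                                            (+-monoʳ-≤ (cv (u ∷ P)) (m≤n+m (cv S) (bit (adj G v v)))) ⟩
      (cu (u ∷ P) + cu (v ∷ S)) + (cv (u ∷ P) + cv (v ∷ S)) ≡⟨ cong₂ _+_ (split _) (split _) ⟩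
      deg G u + deg G v                   ∎
      where
      cu = cnt (adj G u)
      cv = cnt (adj G v)

  -- While there are at least `k` breaks but fewer than `k` bad ones, some break joins two low
  -- vertices and can be rotated away. This lowers the number of all breaks, on which the recursion
  -- is founded, and does not raise the number of bad ones.
  closure : ∀ {k} → Arrangeable bad (allFin n) k → Arrangeable (adj G) (allFin n) k
  closure {k} (σ , perm , lt) = go σ perm lt (<-wellFounded _)
    where
    go : ∀ σ → σ ↭ allFin n → breaks bad σ < k → Acc _<_ (breaks (adj G) σ) → Arrangeable (adj G) (allFin n) k
    go [] perm lt _ = [] , perm , lt
    go σ@(x ∷ xs) perm lt (accessible rec) with breaks (adj G) σ <? k
    ... | yes done = σ , perm , done
    ... | no ≮k with fewer-breaks [] x xs (<-≤-trans lt (≮⇒≥ ≮k))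
    ...   | u , P , v , S , eq , uv , ¬bad with improve u P v S (subst (_↭ allFin n) (sym eq) perm) uv ¬bad
    ...     | τ , perm′ , lt′ , le′ = go τ (↭-trans (subst (τ ↭_) eq perm′) perm)
                (≤-<-trans (subst (λ σ → breaks bad τ ≤ breaks bad σ) eq le′) lt)
                (rec (subst (λ σ → breaks (adj G) τ < breaks (adj G) σ) eq lt′))

  unclosure : ∀ {k} → Arrangeable (adj G) (allFin n) k → Arrangeable bad (allFin n) k
  unclosure (σ , perm , lt) = σ , perm , ≤-<-trans (breaks-mono bad≤adj σ) lt

-- The kernel

-- Vertices are represented by labels under which low vertices with equal neighbourhoods among
-- the high ones coincide.

data Label : Set where
  hi : ℕ → List Bool → Label
  lo : List Bool → Label

bits : Label → List Bool
bits (hi _ b) = b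
bits (lo b)   = b

isHi : Label → Bool
isHi (hi _ _) = true
isHi (lo _)   = false

_at_ : List Bool → ℕ → Bool
[]       at i     = false
(b ∷ bs) at zero  = b
(b ∷ bs) at suc i = bs at i

-- The index of a high vertex is its column in the row of the other vertex, which is why high labels
-- carry one. Rows are masked to the high columns; pairs of low labels do not count, by the closure.
clash : Label → Label → Bool
clash (hi i _) y        = bits y at i
clash (lo b)   (hi j _) = b at j
clash (lo _)   (lo _)   = false

tabulate-at : ∀ {n} (f : Fin n → Bool) i → tabulate f at toℕ i ≡ f i
tabulate-at f zero    = refl
tabulate-at f (suc i) = tabulate-at (f ∘ suc) i

breaks-map : ∀ {A B : Set} {bad : A → A → Bool} {bad′ : B → B → Bool} (f : A → B) →
              (∀ x y → bad′ (f x) (f y) ≡ bad x y) → ∀ xs → breaks bad′ (map f xs) ≡ breaks bad xs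
breaks-map f eq []           = refl
breaks-map f eq (x ∷ [])     = refl
breaks-map f eq (x ∷ y ∷ xs) = cong₂ _+_ (cong bit (eq x y)) (breaks-map f eq (y ∷ xs))

module Labelling {n} (G : Graph n) where
  open Closure G using (bad)

  row : Fin n → List Bool
  row u = tabulate (λ v → high G v ∧ adj G u v)

  mkLabel : Bool → ℕ → List Bool → Label
  mkLabel true  i b = hi i b
  mkLabel false i b = lo b

  label : Fin n → Label
  label u = mkLabel (high G u) (toℕ u) (row u)

  row-at : ∀ u v → row u at toℕ v ≡ high G v ∧ adj G u v
  row-at u v = tabulate-at _ v

  bits-mkLabel : ∀ c i b → bits (mkLabel c i b) ≡ b
  bits-mkLabel true  i b = refl
  bits-mkLabel false i b = refl

  clash-label : ∀ u v → clash (label u) (label v) ≡ bad u v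
  clash-label u v = go (high G u) (high G v) refl refl
    where
    open ≡-Reasoning
    go : ∀ a c → high G u ≡ a → high G v ≡ c →
         clash (mkLabel a (toℕ u) (row u)) (mkLabel c (toℕ v) (row v)) ≡ (high G u ∨ high G v) ∧ adj G u v
    go true c eq _ = begin
      bits (mkLabel c (toℕ v) (row v)) at toℕ u ≡⟨ cong (_at toℕ u) (bits-mkLabel c _ _) ⟩
      row v at toℕ u                            ≡⟨ row-at v u ⟩
      high G u ∧ adj G v u                      ≡⟨ cong₂ _∧_ eq (symmetric G v u) ⟩
      adj G u v                                 ≡⟨ cong (λ a → (a ∨ high G v) ∧ adj G u v) eq ⟨
      (high G u ∨ high G v) ∧ adj G u v         ∎
    go false true eq eq′ = begin
      row u at toℕ v                            ≡⟨ row-at u v ⟩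
      high G v ∧ adj G u v                      ≡⟨ cong (λ a → (a ∨ high G v) ∧ adj G u v) eq ⟨
      (high G u ∨ high G v) ∧ adj G u v         ∎
    go false false eq eq′ rewrite eq | eq′ = refl

  labels : List Label
  labels = tabulate label

  arrange-labels : ∀ {k} → Arrangeable bad (allFin n) k → Arrangeable clash labels k
  arrange-labels (σ , perm , lt) = map label σ ,
    ↭-trans (map⁺ label perm) (↭-reflexive (map-tabulate id label)) ,
    subst (_< _) (sym (breaks-map label clash-label σ)) lt

  arrange-vertices : ∀ {k} → Arrangeable clash labels k → Arrangeable bad (allFin n) k
  arrange-vertices (σ , perm , lt) with ↭-map-inv label (↭-trans (↭-reflexive (map-tabulate id label)) (↭-sym perm))
  ... | τ , refl , perm′ = τ , ↭-sym perm′ , subst (_< _) (breaks-map label clash-label τ) lt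

_==_ : Bool → Bool → Bool
true  == b = b
false == b = not b

eqᵇ : List Bool → List Bool → Bool
eqᵇ []       []       = true
eqᵇ []       (_ ∷ _)  = false
eqᵇ (_ ∷ _)  []       = false
eqᵇ (x ∷ xs) (y ∷ ys) = (x == y) ∧ eqᵇ xs ys

eqᵇ-refl : ∀ xs → eqᵇ xs xs ≡ true
eqᵇ-refl []           = refl
eqᵇ-refl (true ∷ xs)  = eqᵇ-refl xs
eqᵇ-refl (false ∷ xs) = eqᵇ-refl xs

eqᵇ-sound : ∀ xs ys → eqᵇ xs ys ≡ true → xs ≡ ys
eqᵇ-sound []           []           _  = refl
eqᵇ-sound (true ∷ xs)  (true ∷ ys)  eq = cong (true ∷_) (eqᵇ-sound xs ys eq)
eqᵇ-sound (false ∷ xs) (false ∷ ys) eq = cong (false ∷_) (eqᵇ-sound xs ys eq)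

isLo : List Bool → Label → Bool
isLo b (hi _ _) = false
isLo b (lo b′)  = eqᵇ b b′

keep : ℕ → Label → List Label → List Label
keep c (hi i b) K = hi i b ∷ K
keep c (lo b)   K = ifᵇ cnt (isLo b) K <ᵇ c then lo b ∷ K else K

kernel : ℕ → List Label → List Label → List Label
kernel c = foldl (λ K x → keep c x K)

-- The flag stands for the label before the list; it is `false` at the start of an ordering, where
-- nothing high precedes.
LowEnd : Bool → List Label → Set
LowEnd p []       = p ≡ false
LowEnd p (x ∷ xs) = LowEnd (isHi x) xs

LowHead : List Label → Set
LowHead []      = ⊤
LowHead (x ∷ _) = isHi x ≡ false

-- An occurrence of lo b with no high neighbour; the flag p tells whether σ is preceded by a high label.
Occurs : List Bool → Bool → List Label → Set
Occurs b p σ = ∃[ A ] ∃[ B ] (σ ≡ A ++ lo b ∷ B × LowEnd p A × LowHead B)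

occurs-∷ : ∀ {b p σ} x → Occurs b (isHi x) σ → Occurs b p (x ∷ σ)
occurs-∷ x (A , B , eq , a , h) = x ∷ A , B , cong (x ∷_) eq , a , h

-- A high label spoils at most two copies of `lo b`, the one before and the one after it; `bit p`
-- allows for a copy spoilt by the label in front of `σ`.
occurrence : ∀ b p σ → Occurs b p σ ⊎ cnt (isLo b) σ ≤ bit p + 2 * cnt isHi σ
occurrence b p [] = inj₂ z≤n
occurrence b p (hi i a ∷ σ) with occurrence b true σ
... | inj₁ o  = inj₁ (occurs-∷ (hi i a) o)
... | inj₂ le = inj₂ (begin
  cnt (isLo b) σ            ≤⟨ le ⟩
  1 + 2 * h                 ≤⟨ n≤1+n _ ⟩
  2 + 2 * h                 ≡⟨ *-suc 2 h ⟨
  2 * suc h                 ≤⟨ m≤n+m _ (bit p) ⟩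
  bit p + 2 * suc h         ∎)
  where
  open ≤-Reasoning
  h = cnt isHi σ
occurrence b p (lo a ∷ σ) with eqᵇ b a in eq | p | occurrence b false σ
... | _     | _    | inj₁ o  = inj₁ (occurs-∷ (lo a) o)
... | false | p    | inj₂ le = inj₂ (≤-trans le (m≤n+m _ (bit p)))
... | true  | true | inj₂ le = inj₂ (s≤s le)
occurrence b p (lo a ∷ [])          | true | false | inj₂ le =
  inj₁ ([] , [] , cong (λ z → lo z ∷ []) (sym (eqᵇ-sound b a eq)) , refl , tt)
occurrence b p (lo a ∷ lo a′ ∷ σ)   | true | false | inj₂ le =
  inj₁ ([] , lo a′ ∷ σ , cong (λ z → lo z ∷ lo a′ ∷ σ) (sym (eqᵇ-sound b a eq)) , refl , refl)
-- The bound for `hi i a′ ∷ σ` leaves nothing to pay for `lo a`, so the induction restarts behind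
-- the high label: of its two units one is the flag there and the other pays for `lo a`.
occurrence b p (lo a ∷ hi i a′ ∷ σ) | true | false | inj₂ le with occurrence b true σ
... | inj₁ o   = inj₁ (occurs-∷ (lo a) (occurs-∷ (hi i a′) o))
... | inj₂ le′ = inj₂ (≤-trans (s≤s le′) (≤-reflexive (sym (*-suc 2 (cnt isHi σ)))))

-- The labels brought together, if there are two, are low and do not clash.
breaks-delete : ∀ {b p} A B → LowEnd p A → LowHead B → breaks clash (A ++ B) ≤ breaks clash (A ++ lo b ∷ B)
breaks-delete {b} [] B _ _ = m≤n+m _ (junction clash (lo b ∷ []) B)
breaks-delete (lo a ∷ []) []         _ _ = z≤n
breaks-delete (lo a ∷ []) (lo c ∷ B) _ _ = ≤-refl
breaks-delete (x ∷ y ∷ A) B e h = +-monoʳ-≤ (bit (clash x y)) (breaks-delete {p = isHi x} (y ∷ A) B e h)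

breaks-duplicate : ∀ {b} A B → breaks clash (A ++ lo b ∷ lo b ∷ B) ≡ breaks clash (A ++ lo b ∷ B)
breaks-duplicate {b} A B = trans (breaks-mid A (lo b ∷ B)) (sym (breaks-mid A B))

module _ {b R} (many : 2 * cnt isHi R < cnt (isLo b) R) where

  private
    occurs : ∀ {σ} → 2 * cnt isHi R ≡ 2 * cnt isHi σ → cnt (isLo b) R ≤ cnt (isLo b) σ → Occurs b false σ
    occurs {σ} eq le with occurrence b false σ
    ... | inj₁ o   = o
    ... | inj₂ le′ = ⊥-elim (<⇒≱ many (≤-trans le (≤-trans le′ (≤-reflexive (sym eq)))))

  -- The new copy is placed beside an old one, and two low labels do not clash.
  add-copy : ∀ {k} → Arrangeable clash R k → Arrangeable clash (lo b ∷ R) k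
  add-copy (σ , perm , lt)
    with occurs {σ} (cong (2 *_) (∑-↭ _ (↭-sym perm))) (≤-reflexive (∑-↭ _ (↭-sym perm)))
  ... | A , B , refl , _ = A ++ lo b ∷ lo b ∷ B , ↭-trans (shift (lo b) A _) (prep (lo b) perm) ,
        subst (_< _) (sym (breaks-duplicate A B)) lt

  -- By `many` some copy has no high neighbour; copies being equal, it may be taken for the one to
  -- drop.
  drop-copy : ∀ {k} → Arrangeable clash (lo b ∷ R) k → Arrangeable clash R k
  drop-copy (σ , perm , lt)
    with occurs {σ} (cong (2 *_) (∑-↭ _ (↭-sym perm))) (≤-trans (m≤n+m _ (bit (eqᵇ b b))) (≤-reflexive (∑-↭ _ (↭-sym perm))))
  ... | A , B , refl , e , h = A ++ B , drop-mid A [] perm , ≤-<-trans (breaks-delete {p = false} A B e h) lt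

module _ {c : ℕ} where

  -- A label is rejected only once `K` holds `c` copies of it, and `c` exceeds twice the number of
  -- high labels.
  kernel-step : ∀ b {xs K} → 2 * cnt isHi (xs ++ K) < c → (cnt (isLo b) K <ᵇ c) ≡ false →
                2 * cnt isHi (xs ++ K) < cnt (isLo b) (xs ++ K)
  kernel-step b {xs} {K} lt eq = <-≤-trans lt (≤-trans (≮⇒≥ (λ lt → subst T eq (<⇒<ᵇ lt)))
    (≤-trans (m≤n+m _ (cnt (isLo b) xs)) (≤-reflexive (sym (∑-++ xs K _)))))

  arrange-↭ : ∀ {xs ys : List Label} {k} → xs ↭ ys → Arrangeable clash xs k → Arrangeable clash ys k
  arrange-↭ p (σ , q , lt) = σ , ↭-trans q p , lt

  -- The invariant is the arrangeability of `xs ++ K`, the unread labels and those kept; a rejection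
  -- removes a spare copy from it.
  kernel-arrange : ∀ {k} xs K → 2 * cnt isHi (xs ++ K) < c →
                   Arrangeable clash (xs ++ K) k → Arrangeable clash (kernel c K xs) k
  kernel-arrange [] K lt r = r
  kernel-arrange (hi i b ∷ xs) K lt r =
    kernel-arrange xs (hi i b ∷ K) (subst (λ z → 2 * z < c) (∑-↭ _ (↭-sym (shift (hi i b) xs K))) lt)
                   (arrange-↭ (↭-sym (shift (hi i b) xs K)) r)
  kernel-arrange (lo b ∷ xs) K lt r with cnt (isLo b) K <ᵇ c in eq
  ... | true  = kernel-arrange xs (lo b ∷ K) (subst (λ z → 2 * z < c) (∑-↭ _ (↭-sym (shift (lo b) xs K))) lt)
                               (arrange-↭ (↭-sym (shift (lo b) xs K)) r)
  ... | false = kernel-arrange xs K lt (drop-copy (kernel-step b {xs} lt eq) r)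

  unkernel-arrange : ∀ {k} xs K → 2 * cnt isHi (xs ++ K) < c →
                     Arrangeable clash (kernel c K xs) k → Arrangeable clash (xs ++ K) k
  unkernel-arrange [] K lt r = r
  unkernel-arrange (hi i b ∷ xs) K lt r = arrange-↭ (shift (hi i b) xs K)
    (unkernel-arrange xs (hi i b ∷ K) (subst (λ z → 2 * z < c) (∑-↭ _ (↭-sym (shift (hi i b) xs K))) lt) r)
  unkernel-arrange (lo b ∷ xs) K lt r with cnt (isLo b) K <ᵇ c in eq
  ... | true  = arrange-↭ (shift (lo b) xs K)
    (unkernel-arrange xs (lo b ∷ K) (subst (λ z → 2 * z < c) (∑-↭ _ (↭-sym (shift (lo b) xs K))) lt) r)
  ... | false = add-copy (kernel-step b {xs} lt eq) (unkernel-arrange xs K lt r)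

  -- For the running time: folds over the kernel stay within the bound already granted to the input.
  kernel-length : ∀ xs K → length (kernel c K xs) ≤ length xs + length K
  kernel-length [] K = ≤-refl
  kernel-length (hi i b ∷ xs) K = ≤-trans (kernel-length xs _) (≤-reflexive (+-suc (length xs) (length K)))
  kernel-length (lo b ∷ xs) K with cnt (isLo b) K <ᵇ c
  ... | true  = ≤-trans (kernel-length xs _) (≤-reflexive (+-suc (length xs) (length K)))
  ... | false = ≤-trans (kernel-length xs _) (n≤1+n _)

  kernel-hi : ∀ xs K → cnt isHi (kernel c K xs) ≡ cnt isHi (xs ++ K)
  kernel-hi [] K = refl
  kernel-hi (hi i b ∷ xs) K = trans (kernel-hi xs (hi i b ∷ K)) (∑-↭ (bit ∘ isHi) (shift (hi i b) xs K))
  kernel-hi (lo b ∷ xs) K with cnt (isLo b) K <ᵇ c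
  ... | true  = trans (kernel-hi xs (lo b ∷ K)) (∑-↭ (bit ∘ isHi) (shift (lo b) xs K))
  ... | false = kernel-hi xs K

  kernel-all : ∀ {P : Label → Set} xs K → All P xs → All P K → All P (kernel c K xs)
  kernel-all [] K _ ps = ps
  kernel-all (hi i b ∷ xs) K (q ∷ qs) ps = kernel-all xs _ qs (q ∷ ps)
  kernel-all (lo b ∷ xs) K (q ∷ qs) ps with cnt (isLo b) K <ᵇ c
  ... | true  = kernel-all xs _ qs (q ∷ ps)
  ... | false = kernel-all xs _ qs ps

  kernel-copies : ∀ xs K → (∀ a → cnt (isLo a) K ≤ c) → ∀ a → cnt (isLo a) (kernel c K xs) ≤ c
  kernel-copies [] K le = le
  kernel-copies (hi i b ∷ xs) K le = kernel-copies xs _ le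
  kernel-copies (lo b ∷ xs) K le with cnt (isLo b) K <ᵇ c in eq
  ... | false = kernel-copies xs _ le
  ... | true  = kernel-copies xs _ le′
    where
    le′ : ∀ a → cnt (isLo a) (lo b ∷ K) ≤ c
    le′ a with eqᵇ a b in eq′
    ... | false = le a
    ... | true rewrite eqᵇ-sound a b eq′ = <ᵇ⇒< _ c (subst T (sym eq) tt)

-- The size of the kernel

lows : List Label → List (List Bool)
lows []            = []
lows (hi _ _ ∷ xs) = lows xs
lows (lo b ∷ xs)   = b ∷ lows xs

length-lows : ∀ xs → length xs ≡ cnt isHi xs + length (lows xs)
length-lows []            = refl
length-lows (hi _ _ ∷ xs) = cong suc (length-lows xs)
length-lows (lo b ∷ xs)   = trans (cong suc (length-lows xs)) (sym (+-suc (cnt isHi xs) _))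

cnt-lows : ∀ a xs → cnt (eqᵇ a) (lows xs) ≡ cnt (isLo a) xs
cnt-lows a []            = refl
cnt-lows a (hi _ _ ∷ xs) = cnt-lows a xs
cnt-lows a (lo b ∷ xs)   = cong (bit (eqᵇ a b) +_) (cnt-lows a xs)

lows-all : ∀ {P : List Bool → Set} {xs} → All (P ∘ bits) xs → All P (lows xs)
lows-all {xs = []}          _        = []
lows-all {xs = hi _ _ ∷ _} (_ ∷ ps) = lows-all ps
lows-all {xs = lo _ ∷ _}   (p ∷ ps) = p ∷ lows-all ps

remove : List Bool → List (List Bool) → List (List Bool)
remove e []       = []
remove e (b ∷ bs) = ifᵇ eqᵇ e b then remove e bs else b ∷ remove e bs

length-remove : ∀ e bs → length bs ≡ cnt (eqᵇ e) bs + length (remove e bs)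
length-remove e []       = refl
length-remove e (b ∷ bs) with eqᵇ e b
... | true  = cong suc (length-remove e bs)
... | false = trans (cong suc (length-remove e bs)) (sym (+-suc (cnt (eqᵇ e) bs) _))

cnt-remove : ∀ e a bs → cnt (eqᵇ a) (remove e bs) ≤ cnt (eqᵇ a) bs
cnt-remove e a []       = z≤n
cnt-remove e a (b ∷ bs) with eqᵇ e b
... | true  = ≤-trans (cnt-remove e a bs) (m≤n+m _ (bit (eqᵇ a b)))
... | false = +-monoʳ-≤ (bit (eqᵇ a b)) (cnt-remove e a bs)

remove-all : ∀ e {E} bs → All (_∈ e ∷ E) bs → All (_∈ E) (remove e bs)
remove-all e []       []       = []
remove-all e (b ∷ bs) (p ∷ ps) with eqᵇ e b in eq | p
... | true  | _         = remove-all e bs ps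
... | false | there p   = p ∷ remove-all e bs ps
... | false | here refl with () ← trans (sym eq) (eqᵇ-refl e)

pigeonhole : ∀ E bs {c} → All (_∈ E) bs → (∀ a → cnt (eqᵇ a) bs ≤ c) → length bs ≤ length E * c
pigeonhole []      []       _        le = z≤n
pigeonhole []      (_ ∷ _)  (() ∷ _) le
pigeonhole (e ∷ E) bs {c}   ps       le = begin
  length bs                                 ≡⟨ length-remove e bs ⟩
  cnt (eqᵇ e) bs + length (remove e bs)     ≤⟨ +-mono-≤ (le e) (pigeonhole E (remove e bs) (remove-all e bs ps)
                                                 (λ a → ≤-trans (cnt-remove e a bs) (le a))) ⟩
  c + length E * c                          ∎
  where open ≤-Reasoning

submasks : List Bool → List (List Bool)
submasks []          = [] ∷ []
submasks (false ∷ m) = map (false ∷_) (submasks m)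
submasks (true ∷ m)  = map (false ∷_) (submasks m) ++ map (true ∷_) (submasks m)

length-submasks : ∀ m → length (submasks m) ≡ 2 ^ cnt id m
length-submasks []          = refl
length-submasks (false ∷ m) = trans (length-map _ (submasks m)) (length-submasks m)
length-submasks (true ∷ m)  = trans (length-++ (map (false ∷_) (submasks m)))
  (trans (cong₂ _+_ (trans (length-map _ (submasks m)) (length-submasks m))
                    (trans (length-map _ (submasks m)) (length-submasks m)))
         (cong (2 ^ cnt id m +_) (sym (+-identityʳ _))))

-- Bounds the number of classes: rows are masked by the high vertices, so at most 2 ^ h different
-- ones occur.
∈-submasks : ∀ {n} (m f : Fin n → Bool) → tabulate (λ v → m v ∧ f v) ∈ submasks (tabulate m)
∈-submasks {zero}  m f = here refl
∈-submasks {suc n} m f with m zero | f zero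
... | false | _     = ∈-map⁺ (false ∷_) (∈-submasks (m ∘ suc) (f ∘ suc))
... | true  | false = ∈-++⁺ˡ (∈-map⁺ (false ∷_) (∈-submasks (m ∘ suc) (f ∘ suc)))
... | true  | true  = ∈-++⁺ʳ (map (false ∷_) (submasks (tabulate (m ∘ suc)))) (∈-map⁺ (true ∷_) (∈-submasks (m ∘ suc) (f ∘ suc)))

module _ {n} (G : Graph n) where
  open Labelling G

  highs : ℕ
  highs = cnt (high G) (allFin n)

  labels-hi : cnt isHi labels ≡ highs
  labels-hi = trans (∑-tabulate label (bit ∘ isHi)) (∑-cong (allFin n) (λ u → cong bit (isHi-mkLabel (high G u))))
    where
    isHi-mkLabel : ∀ {i b} c → isHi (mkLabel c i b) ≡ c
    isHi-mkLabel true  = refl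
    isHi-mkLabel false = refl

  -- The program can count `highs` but is not told w, so the threshold is the least number above
  -- twice `highs`.
  core : List Label
  core = kernel (suc (2 * highs)) [] labels

  kernel-size : length core ≤ highs + 2 ^ highs * suc (2 * highs)
  kernel-size = begin
    length core                              ≡⟨ length-lows core ⟩
    cnt isHi core + length (lows core)          ≤⟨ +-mono-≤ (≤-reflexive hi≡) (pigeonhole (submasks mask) (lows core) (lows-all rows) copies) ⟩
    highs + length (submasks mask) * c    ≡⟨ cong (λ z → highs + z * c) (trans (length-submasks mask) (cong (2 ^_) (∑-tabulate (high G) bit))) ⟩
    highs + 2 ^ highs * c                 ∎
    where
    open ≤-Reasoning
    c = suc (2 * highs)
    mask = tabulate (high G)
    hi≡ : cnt isHi core ≡ highs
    hi≡ = trans (kernel-hi labels []) (trans (cong (cnt isHi) (++-identityʳ labels)) labels-hi)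
    rows : All (λ x → bits x ∈ submasks mask) core
    rows = kernel-all labels [] (tabulate⁺ (λ u → subst (_∈ submasks mask) (sym (bits-mkLabel (high G u) _ _)) (∈-submasks (high G) (adj G u)))) []
    copies : ∀ a → cnt (eqᵇ a) (lows core) ≤ c
    copies a = ≤-trans (≤-reflexive (cnt-lows a core)) (kernel-copies labels [] (λ _ → z≤n) a)

  kernel-correct : ∀ {k} → (Arrangeable (adj G) (allFin n) k → Arrangeable clash core k) ×
                           (Arrangeable clash core k → Arrangeable (adj G) (allFin n) k)
  kernel-correct {k} =
    (λ r → kernel-arrange labels [] small (subst (λ z → Arrangeable clash z k) (sym (++-identityʳ labels))
             (arrange-labels (Closure.unclosure G r)))) ,
    (λ r → Closure.closure G (arrange-vertices (subst (λ z → Arrangeable clash z k) (++-identityʳ labels)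
             (unkernel-arrange labels [] small r))))
    where
    small : 2 * cnt isHi (labels ++ []) < suc (2 * highs)
    small = s≤s (≤-reflexive (cong (2 *_) (trans (cong (cnt isHi) (++-identityʳ labels)) labels-hi)))

-- Enumeration of permutations

module _ {A : Set} where

  -- Accumulators and a reversed prefix replace maps and concatenations, so that the enumeration
  -- consists of left folds, as it does in the program.
  inserts : A → List A → List A → List (List A) → List (List A)
  inserts x xs []       acc = (xs ʳ++ x ∷ []) ∷ acc
  inserts x xs (y ∷ ys) acc = inserts x (y ∷ xs) ys ((xs ʳ++ x ∷ y ∷ ys) ∷ acc)

  insertAll : A → List (List A) → List (List A) → List (List A)
  insertAll x ps acc = foldl (λ acc p → inserts x [] p acc) acc ps

  perms : List A → List (List A) → List (List A)
  perms xs ps = foldl (λ ps x → insertAll x ps []) ps xs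

  length-inserts : ∀ x xs ys acc → length (inserts x xs ys acc) ≡ suc (length ys) + length acc
  length-inserts x xs []       acc = refl
  length-inserts x xs (y ∷ ys) acc = trans (length-inserts x (y ∷ xs) ys _) (cong suc (+-suc (length ys) (length acc)))

  inserts-acc : ∀ {σ} x xs ys acc → σ ∈ acc → σ ∈ inserts x xs ys acc
  inserts-acc x xs []       acc p = there p
  inserts-acc x xs (y ∷ ys) acc p = inserts-acc x (y ∷ xs) ys _ (there p)

  ∈-inserts : ∀ x xs ys zs acc → xs ʳ++ ys ++ x ∷ zs ∈ inserts x xs (ys ++ zs) acc
  ∈-inserts x xs []       []       acc = here refl
  ∈-inserts x xs []       (z ∷ zs) acc = inserts-acc x (z ∷ xs) zs _ (here refl)
  ∈-inserts x xs (y ∷ ys) zs       acc = ∈-inserts x (y ∷ xs) ys zs _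

  inserts-↭ : ∀ {zs} x xs ys acc → xs ʳ++ ys ↭ zs → All (_↭ x ∷ zs) acc → All (_↭ x ∷ zs) (inserts x xs ys acc)
  inserts-↭ {zs} x xs ys acc perm ps = go ys perm
    where
    inserted : ∀ ys → xs ʳ++ ys ↭ zs → xs ʳ++ x ∷ ys ↭ x ∷ zs
    inserted ys perm = ↭-trans (↭-ʳ++ (x ∷ xs) ys) (prep x (↭-trans (↭-sym (↭-ʳ++ xs ys)) perm))
    go : ∀ ys → xs ʳ++ ys ↭ zs → All (_↭ x ∷ zs) (inserts x xs ys acc)
    go []       perm = inserted [] perm ∷ ps
    go (y ∷ ys) perm = inserts-↭ x (y ∷ xs) ys _ perm (inserted (y ∷ ys) perm ∷ ps)

  insertAll-acc : ∀ {σ} x ps acc → σ ∈ acc → σ ∈ insertAll x ps acc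
  insertAll-acc x []       acc p = p
  insertAll-acc x (q ∷ qs) acc p = insertAll-acc x qs _ (inserts-acc x [] q acc p)

  ∈-insertAll : ∀ x ys zs ps acc → ys ++ zs ∈ ps → ys ++ x ∷ zs ∈ insertAll x ps acc
  ∈-insertAll x ys zs (_ ∷ ps) acc (here refl) = insertAll-acc x ps _ (∈-inserts x [] ys zs acc)
  ∈-insertAll x ys zs (_ ∷ ps) acc (there p)   = ∈-insertAll x ys zs ps _ p

  insertAll-↭ : ∀ {zs} x ps acc → All (_↭ zs) ps → All (_↭ x ∷ zs) acc → All (_↭ x ∷ zs) (insertAll x ps acc)
  insertAll-↭ x []       acc []       as = as
  insertAll-↭ x (p ∷ ps) acc (q ∷ qs) as = insertAll-↭ x ps _ qs (inserts-↭ x [] p acc q as)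

  length-insertAll : ∀ {zs} x ps acc → All (_↭ zs) ps →
                     length (insertAll x ps acc) ≡ length ps * suc (length zs) + length acc
  length-insertAll x []       acc []       = refl
  length-insertAll {zs} x (p ∷ ps) acc (q ∷ qs) = begin
    length (insertAll x ps (inserts x [] p acc))     ≡⟨ length-insertAll x ps _ qs ⟩
    m + length (inserts x [] p acc)                  ≡⟨ cong (m +_) (trans (length-inserts x [] p acc) (cong (λ z → suc z + a) (↭-length q))) ⟩
    m + (suc (length zs) + a)                        ≡⟨ +-assoc m _ a ⟨
    (m + suc (length zs)) + a                        ≡⟨ cong (_+ a) (+-comm m _) ⟩
    (suc (length zs) + m) + a                        ∎
    where
    open ≡-Reasoning
    m = length ps * suc (length zs)
    a = length acc

  Enumerates : List (List A) → List A → Set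
  Enumerates ps zs = All (_↭ zs) ps × (∀ {σ} → σ ↭ zs → σ ∈ ps)

  insertAll-enumerates : ∀ x {ps zs} → Enumerates ps zs → Enumerates (insertAll x ps []) (x ∷ zs)
  insertAll-enumerates x {ps} {zs} (sound , complete) = insertAll-↭ x ps [] sound [] , complete′
    where
    complete′ : ∀ {σ} → σ ↭ x ∷ zs → σ ∈ insertAll x ps []
    complete′ perm with ∈-∃++ (∈-resp-↭ (↭-sym perm) (here refl))
    ... | ys , ws , refl = ∈-insertAll x ys ws ps [] (complete (drop-mid ys [] perm))

  perms-enumerates : ∀ xs {ps zs} → Enumerates ps zs → Enumerates (perms xs ps) (xs ʳ++ zs)
  perms-enumerates []       e = e
  perms-enumerates (x ∷ xs) e = perms-enumerates xs (insertAll-enumerates x e)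

  -- Each insertion multiplies the number of lists by at most `s`. The power is cruder than the
  -- factorial, but a bound in w alone is all that is wanted.
  length-perms : ∀ {s} xs {ps zs} → Enumerates ps zs → length zs + length xs ≤ s →
                 length (perms xs ps) ≤ length ps * s ^ length xs
  length-perms []       {ps} e le = ≤-reflexive (sym (*-identityʳ (length ps)))
  length-perms {s} (x ∷ xs) {ps} {zs} e le = begin
    length (perms xs (insertAll x ps []))    ≤⟨ length-perms xs (insertAll-enumerates x e) le′ ⟩
    length (insertAll x ps []) * s ^ length xs ≡⟨ cong (_* s ^ length xs) (trans (length-insertAll x ps [] (proj₁ e)) (+-identityʳ _)) ⟩
    length ps * suc (length zs) * s ^ length xs ≤⟨ *-monoˡ-≤ (s ^ length xs) (*-monoʳ-≤ (length ps) (≤-trans (s≤s (m≤m+n _ _)) le′)) ⟩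
    length ps * s * s ^ length xs            ≡⟨ *-assoc (length ps) s _ ⟩
    length ps * s ^ suc (length xs)          ∎
    where
    open ≤-Reasoning
    le′ : suc (length zs) + length xs ≤ s
    le′ = ≤-trans (≤-reflexive (sym (+-suc (length zs) (length xs)))) le

  allPerms : List A → List (List A)
  allPerms xs = perms xs ([] ∷ [])

  allPerms-enumerates : ∀ xs → Enumerates (allPerms xs) xs
  allPerms-enumerates xs with perms-enumerates xs {zs = []} (↭-refl ∷ [] , λ p → here (↭-empty-inv p))
  ... | sound , complete = All.map (λ p → ↭-trans p reversed) sound , λ p → complete (↭-trans p (↭-sym reversed))
    where
    reversed : xs ʳ++ [] ↭ xs
    reversed = ↭-trans (↭-ʳ++ xs []) (↭-reflexive (++-identityʳ xs))

  length-allPerms : ∀ xs → length (allPerms xs) ≤ length xs ^ length xs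
  length-allPerms xs = ≤-trans (length-perms xs {zs = []} (↭-refl ∷ [] , λ p → here (↭-empty-inv p)) ≤-refl) (≤-reflexive (*-identityˡ _))

-- The program

-- Value and bound go together, since `Bounded` for a composition or a fold refers to the values of
-- its parts.
record Ev (N : ℕ) (f : Fun) (x y : Tree) : Set where
  constructor ev
  field
    value   : ⟦ f ⟧ x ≡ y
    bounded : Bounded N f x

module _ {N : ℕ} where

  ev-∙ : ∀ {f g x a b} → Ev N f x a → Ev N g x b → Ev N (f ∙ᶠ g) x (a ∙ b)
  ev-∙ (ev p b) (ev q c) = ev (cong₂ _∙_ p q) (b , c)

  ev-∘ : ∀ {f g x y z} → Ev N f x y → Ev N g y z → Ev N (g ∘ᶠ f) x z
  ev-∘ (ev refl b) (ev q c) = ev q (b , c)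

  ev-hd : ∀ {f x y} → Ev N f x y → Ev N (hdᶠ f) x (hd y)
  ev-hd (ev p b) = ev (cong hd p) b

  ev-tl : ∀ {f x y} → Ev N f x y → Ev N (tlᶠ f) x (tl y)
  ev-tl (ev p b) = ev (cong tl p) b

  ev-if : ∀ {c f g x t a b} → Ev N c x t → Ev N f x a → Ev N g x b → Ev N (condᶠ c f g) x (ite t a b)
  ev-if (ev refl b) (ev refl b′) (ev refl b″) = ev refl (b , b′ , b″)

  ev-≡ : ∀ {f x y z} → y ≡ z → Ev N f x y → Ev N f x z
  ev-≡ refl e = e

  -- R relates the remaining list and the accumulator.
  module _ {A B : Set} {cA : A → Tree} {cB : B → Tree} {f : Fun} {x : Tree}
           (step : B → A → B) (R : List A → B → Set)
           (sound : ∀ a as b → R (a ∷ as) b →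
                    Ev N f ((cA a ∙ cB b) ∙ x) (cB (step b a)) × R as (step b a)) where

    ev-iter : ∀ as b → R as b →
              iter ⟦ f ⟧ x (codeList (map cA as)) (cB b) ≡ cB (foldl step b as) ×
              IterBounded (Bounded N f) ⟦ f ⟧ x (codeList (map cA as)) (cB b)
    ev-iter []       b r = refl , tt
    ev-iter (a ∷ as) b r with sound a as b r
    ... | ev p bd , r′ rewrite p = let q , bds = ev-iter as (step b a) r′ in q , (bd , bds)

    spine-codeList : ∀ as → spine (codeList (map cA as)) ≡ length as
    spine-codeList []       = refl
    spine-codeList (a ∷ as) = cong suc (spine-codeList as)

    ev-fold : ∀ {l i} as b → R as b → length as ≤ N → Ev N l x (codeList (map cA as)) → Ev N i x (cB b) →
              Ev N (foldᶠ l i f) x (cB (foldl step b as))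
    ev-fold {l} {i} as b r le (ev p bl) (ev q bi) with ev-iter as b r
    ... | v , bs = ev (trans (cong₂ (iter ⟦ f ⟧ x) p q) v)
                      (bl , bi , subst (_≤ N) (sym (trans (cong spine p) (spine-codeList as))) le ,
                       subst₂ (IterBounded (Bounded N f) ⟦ f ⟧ x) (sym p) (sym q) bs)

codeBits : List Bool → Tree
codeBits bs = codeList (map codeBool bs)

-- The 0 for low labels is a harmless default: `clashᶠ` reads it only in a branch not taken, which
-- must be bounded all the same.
idx : Label → ℕ
idx (hi i _) = i
idx (lo _)   = 0

codeLabel : Label → Tree
codeLabel x = codeBool (isHi x) ∙ codeℕ (idx x) ∙ codeBits (bits x)

codeLabels : List Label → Tree
codeLabels xs = codeList (map codeLabel xs)

codePerms : List (List Label) → Tree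
codePerms ps = codeList (map codeLabels ps)

elem accum env 𝟏 : Fun
elem = hdᶠ (hdᶠ arg)
accum = tlᶠ (hdᶠ arg)
env  = tlᶠ arg
𝟏    = nilᶠ ∙ᶠ nilᶠ

-- Bounds are counted down, so that reaching them is a test for nil.  In particular highᶠ expects a
-- row and the list of all rows, which serves as the numeral n.
revAppᶠ revᶠ highᶠ maskᶠ rowᶠ labelsᶠ budgetᶠ eqᶠ countᶠ keepᶠ kernelᶠ : Fun
revAppᶠ = foldᶠ (hdᶠ arg) (tlᶠ arg) (elem ∙ᶠ accum)
revᶠ    = revAppᶠ ∘ᶠ (arg ∙ᶠ nilᶠ)
highᶠ   = condᶠ (foldᶠ (hdᶠ arg) (tlᶠ arg) (condᶠ elem (tlᶠ (tlᶠ accum)) accum)) nilᶠ 𝟏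
maskᶠ   = revᶠ ∘ᶠ foldᶠ arg nilᶠ ((highᶠ ∘ᶠ (elem ∙ᶠ env)) ∙ᶠ accum)
rowᶠ    = revᶠ ∘ᶠ tlᶠ (foldᶠ (hdᶠ arg) (tlᶠ arg ∙ᶠ nilᶠ)
                        (tlᶠ (hdᶠ accum) ∙ᶠ condᶠ elem (hdᶠ (hdᶠ accum)) nilᶠ ∙ᶠ tlᶠ accum))
labelsᶠ = revᶠ ∘ᶠ tlᶠ (tlᶠ (foldᶠ (tlᶠ arg) (hdᶠ arg ∙ᶠ nilᶠ ∙ᶠ nilᶠ)
  (tlᶠ (hdᶠ accum) ∙ᶠ (nilᶠ ∙ᶠ hdᶠ (tlᶠ accum)) ∙ᶠ
   (condᶠ (hdᶠ (hdᶠ accum)) 𝟏 nilᶠ ∙ᶠ condᶠ (hdᶠ (hdᶠ accum)) (hdᶠ (tlᶠ accum)) nilᶠ ∙ᶠ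
    (rowᶠ ∘ᶠ (hdᶠ env ∙ᶠ elem))) ∙ᶠ tlᶠ (tlᶠ accum))))
budgetᶠ = foldᶠ arg 𝟏 (condᶠ elem (nilᶠ ∙ᶠ nilᶠ ∙ᶠ accum) accum)
eqᶠ     = condᶠ (tlᶠ arg) nilᶠ (hdᶠ arg) ∘ᶠ foldᶠ (hdᶠ arg) (𝟏 ∙ᶠ tlᶠ arg)
  (condᶠ (tlᶠ accum) (condᶠ elem (condᶠ (hdᶠ (tlᶠ accum)) (hdᶠ accum) nilᶠ)
                                (condᶠ (hdᶠ (tlᶠ accum)) nilᶠ (hdᶠ accum))) nilᶠ
   ∙ᶠ tlᶠ (tlᶠ accum))
countᶠ  = foldᶠ (tlᶠ (tlᶠ arg)) (hdᶠ arg)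
  (condᶠ (condᶠ (hdᶠ elem) nilᶠ (eqᶠ ∘ᶠ (tlᶠ (tlᶠ (hdᶠ (tlᶠ env))) ∙ᶠ tlᶠ (tlᶠ elem)))) (tlᶠ accum) accum)
keepᶠ   = foldᶠ (tlᶠ arg) nilᶠ
  (condᶠ (hdᶠ elem) (elem ∙ᶠ accum)
    (condᶠ (countᶠ ∘ᶠ (hdᶠ env ∙ᶠ elem ∙ᶠ accum)) (elem ∙ᶠ accum) accum))
kernelᶠ = keepᶠ ∘ᶠ (budgetᶠ ∘ᶠ hdᶠ arg ∙ᶠ labelsᶠ) ∘ᶠ (maskᶠ ∙ᶠ arg)

-- breaksᶠ starts from lo [] as predecessor, which clashes with nothing.
insertedᶠ insertsᶠ insertAllᶠ permsᶠ atᶠ clashᶠ breaksᶠ checkᶠ mainᶠ : Fun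
insertedᶠ  = revAppᶠ ∘ᶠ (hdᶠ (tlᶠ arg) ∙ᶠ hdᶠ arg ∙ᶠ hdᶠ (tlᶠ (tlᶠ arg))) ∙ᶠ tlᶠ (tlᶠ (tlᶠ arg))
insertsᶠ   = insertedᶠ ∘ᶠ (hdᶠ arg ∙ᶠ foldᶠ (hdᶠ (tlᶠ arg)) (nilᶠ ∙ᶠ tlᶠ arg)
  ((elem ∙ᶠ hdᶠ accum) ∙ᶠ tlᶠ (hdᶠ (tlᶠ accum)) ∙ᶠ insertedᶠ ∘ᶠ (hdᶠ env ∙ᶠ accum)))
insertAllᶠ = foldᶠ (tlᶠ arg) nilᶠ (insertsᶠ ∘ᶠ (hdᶠ env ∙ᶠ elem ∙ᶠ accum))
permsᶠ     = foldᶠ arg 𝟏 (insertAllᶠ ∘ᶠ (elem ∙ᶠ accum))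
atᶠ        = hdᶠ (foldᶠ (hdᶠ arg) (tlᶠ arg) (tlᶠ accum))
clashᶠ     = condᶠ (hdᶠ (hdᶠ arg)) (atᶠ ∘ᶠ (hdᶠ (tlᶠ (hdᶠ arg)) ∙ᶠ tlᶠ (tlᶠ (tlᶠ arg))))
  (condᶠ (hdᶠ (tlᶠ arg)) (atᶠ ∘ᶠ (hdᶠ (tlᶠ (tlᶠ arg)) ∙ᶠ tlᶠ (tlᶠ (hdᶠ arg)))) nilᶠ)
breaksᶠ    = tlᶠ (foldᶠ (hdᶠ arg) ((nilᶠ ∙ᶠ nilᶠ ∙ᶠ nilᶠ) ∙ᶠ tlᶠ arg)
  (elem ∙ᶠ condᶠ (clashᶠ ∘ᶠ (hdᶠ accum ∙ᶠ elem)) (tlᶠ (tlᶠ accum)) (tlᶠ accum)))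
checkᶠ     = foldᶠ (hdᶠ arg) nilᶠ (condᶠ (breaksᶠ ∘ᶠ (elem ∙ᶠ tlᶠ env)) 𝟏 accum)
mainᶠ      = checkᶠ ∘ᶠ ((permsᶠ ∘ᶠ kernelᶠ ∘ᶠ hdᶠ arg) ∙ᶠ tlᶠ arg)

-- Evaluation of the programs on lists

any-state : ∀ {A B : Set} → List A → B → Set
any-state _ _ = ⊤

tl-codeList : ∀ {A : Set} {c : A → Tree} xs → tl (codeList (map c xs)) ≡ codeList (map c (drop 1 xs))
tl-codeList []      = refl
tl-codeList (_ ∷ _) = refl

pop : List Tree → Bool → List Tree
pop ts true  = drop 2 ts
pop ts false = ts

-- Each true bit removes two members of `ts`, so the list is exhausted exactly when it is at most
-- twice as long as the number of true bits.
pops-high : ∀ ts bs → ite (codeList (foldl pop ts bs)) nil (nil ∙ nil) ≡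
                      codeBool (length ts ≤ᵇ cnt id bs + cnt id bs)
pops-high []           []           = refl
pops-high (t ∷ ts)     []           = refl
pops-high ts           (false ∷ bs) = pops-high ts bs
pops-high []           (true ∷ bs)  = pops-high [] bs
pops-high (t ∷ [])     (true ∷ bs)  = pops-high [] bs
pops-high (t ∷ u ∷ ts) (true ∷ bs)  = trans (pops-high ts bs)
  (trans (cong codeBool (≤ᵇ-suc (length ts) (cnt id bs + cnt id bs)))
         (cong (λ m → codeBool (suc (length ts) <ᵇ suc m)) (sym (+-suc (cnt id bs) (cnt id bs)))))
  where
  ≤ᵇ-suc : ∀ m n → (m ≤ᵇ n) ≡ (m <ᵇ suc n)
  ≤ᵇ-suc zero    n = refl
  ≤ᵇ-suc (suc m) n = refl

maskStep : List Bool × List Bool → Bool → List Bool × List Bool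
maskStep ([]    , out) m = [] , false ∷ out
maskStep (b ∷ r , out) m = r , (m ∧ b) ∷ out

maskStep-tabulate : ∀ {n} (f g : Fin n → Bool) out →
                    foldl maskStep (tabulate g , out) (tabulate f) ≡ ([] , tabulate (λ v → f v ∧ g v) ʳ++ out)
maskStep-tabulate {zero}  f g out = refl
maskStep-tabulate {suc n} f g out = maskStep-tabulate (f ∘ suc) (g ∘ suc) _

-- A second list that is too short clears the flag; one that is too long leaves a remainder, which
-- is tested after the fold.
eqStep : Bool × List Bool → Bool → Bool × List Bool
eqStep (ok , [])     x = false , []
eqStep (ok , y ∷ ys) x = ok ∧ (x == y) , ys

decrease : Bool → ℕ → ℕ
decrease true  m = pred m
decrease false m = m

tl-codeℕ : ∀ m → tl (codeℕ m) ≡ codeℕ (pred m)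
tl-codeℕ zero    = refl
tl-codeℕ (suc m) = refl

ite-decrease : ∀ b m → ite (codeBool b) (tl (codeℕ m)) (codeℕ m) ≡ codeℕ (decrease b m)
ite-decrease true  m = tl-codeℕ m
ite-decrease false m = refl

decrease-∸ : ∀ b m c → decrease b m ∸ c ≡ m ∸ (bit b + c)
decrease-∸ true  zero    c = 0∸n≡0 c
decrease-∸ true  (suc m) c = refl
decrease-∸ false m       c = refl

module _ {N : ℕ} where

  revApp-ev : ∀ {A : Set} {c : A → Tree} xs ys → length xs ≤ N →
              Ev N revAppᶠ (codeList (map c xs) ∙ codeList (map c ys)) (codeList (map c (xs ʳ++ ys)))
  revApp-ev {c = c} xs ys le =
    ev-fold {cA = c} {cB = codeList ∘ map c} (λ b a → a ∷ b) any-state (λ _ _ _ _ → ev refl _ , tt)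
            xs ys tt le (ev refl _) (ev refl _)

  rev-ev : ∀ {A : Set} {c : A → Tree} xs → length xs ≤ N →
           Ev N revᶠ (codeList (map c xs)) (codeList (map c (reverse xs)))
  rev-ev {c = c} xs le = ev-∘ (ev refl _) (revApp-ev {c = c} xs [] le)

  high-ev : ∀ bs ts → length bs ≤ N →
            Ev N highᶠ (codeBits bs ∙ codeList ts) (codeBool (length ts ≤ᵇ cnt id bs + cnt id bs))
  high-ev bs ts le = ev-≡ (pops-high ts bs)
    (ev-if (ev-fold {cA = codeBool} {cB = codeList} pop any-state sound bs ts tt le (ev refl _) (ev refl _))
           (ev refl _) (ev refl _))
    where
    sound : ∀ {x} a (as : List Bool) b → ⊤ → Ev N (condᶠ elem (tlᶠ (tlᶠ accum)) accum) ((codeBool a ∙ codeList b) ∙ x) (codeList (pop b a)) × ⊤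
    sound true  _ []          _ = ev refl _ , tt
    sound true  _ (_ ∷ [])    _ = ev refl _ , tt
    sound true  _ (_ ∷ _ ∷ _) _ = ev refl _ , tt
    sound false _ _           _ = ev refl _ , tt

  at-ev : ∀ i bs → i ≤ N → Ev N atᶠ (codeℕ i ∙ codeBits bs) (codeBool (bs at i))
  at-ev i bs le = ev-≡ (pops-at i bs) (ev-hd
    -- A numeral is a list of nils, so it is folded over as a list of units.
    (ev-fold {cA = λ _ → nil} {cB = codeBits} (λ b _ → drop 1 b) any-state sound (replicate i tt) bs tt
             (subst (_≤ N) (sym (length-replicate i)) le) (ev (numeral i) _) (ev refl _)))
    where
    sound : ∀ {x} (a : ⊤) (as : List ⊤) b → ⊤ → Ev N (tlᶠ accum) ((nil ∙ codeBits b) ∙ x) (codeBits (drop 1 b)) × ⊤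
    sound _ _ []      _ = ev refl _ , tt
    sound _ _ (_ ∷ _) _ = ev refl _ , tt
    numeral : ∀ i → codeℕ i ≡ codeList (map (λ _ → nil) (replicate i tt))
    numeral zero    = refl
    numeral (suc i) = cong (nil ∙_) (numeral i)
    pops-at : ∀ i bs → hd (codeBits (foldl (λ b _ → drop 1 b) bs (replicate i tt))) ≡ codeBool (bs at i)
    pops-at zero    []       = refl
    pops-at zero    (b ∷ bs) = refl
    pops-at (suc i) []       = pops-at i []
    pops-at (suc i) (b ∷ bs) = pops-at i bs

  row-ev : ∀ {n} (f g : Fin n → Bool) → n ≤ N →
           Ev N rowᶠ (codeBits (tabulate f) ∙ codeBits (tabulate g)) (codeBits (tabulate (λ v → f v ∧ g v)))
  row-ev {n} f g le = ev-≡ (cong codeBits (reverse-involutive xs)) (ev-∘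
    (ev-≡ (cong (codeBits ∘ proj₂) (maskStep-tabulate f g []))
      (ev-tl (ev-fold {cA = codeBool} {cB = λ (r , out) → codeBits r ∙ codeBits out} maskStep any-state sound
                (tabulate f) (tabulate g , []) tt (subst (_≤ N) (sym (length-tabulate f)) le) (ev refl _) (ev refl _))))
    (rev-ev {c = codeBool} (reverse xs) (subst (_≤ N) (sym (trans (length-reverse xs) (length-tabulate _))) le)))
    where
    xs = tabulate (λ v → f v ∧ g v)
    body = tlᶠ (hdᶠ accum) ∙ᶠ condᶠ elem (hdᶠ (hdᶠ accum)) nilᶠ ∙ᶠ tlᶠ accum
    sound : ∀ {x} a (as : List Bool) (b : List Bool × List Bool) → ⊤ →
            Ev N body ((codeBool a ∙ codeBits (proj₁ b) ∙ codeBits (proj₂ b)) ∙ x)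
               (codeBits (proj₁ (maskStep b a)) ∙ codeBits (proj₂ (maskStep b a))) × ⊤
    sound true  _ ([]    , _) _ = ev refl _ , tt
    sound true  _ (_ ∷ _ , _) _ = ev refl _ , tt
    sound false _ ([]    , _) _ = ev refl _ , tt
    sound false _ (_ ∷ _ , _) _ = ev refl _ , tt

  budget-ev : ∀ bs → length bs ≤ N → Ev N budgetᶠ (codeBits bs) (codeℕ (suc (2 * cnt id bs)))
  budget-ev bs le = ev-≡ (cong codeℕ (trans (total bs 1) (trans (+-suc _ 0) (cong suc (+-identityʳ _)))))
    (ev-fold {cA = codeBool} {cB = codeℕ} grow any-state sound bs 1 tt le (ev refl _) (ev refl _))
    where
    grow : ℕ → Bool → ℕ
    grow m true  = 2 + m
    grow m false = m
    sound : ∀ {x} a (as : List Bool) b → ⊤ → Ev N (condᶠ elem (nilᶠ ∙ᶠ nilᶠ ∙ᶠ accum) accum) ((codeBool a ∙ codeℕ b) ∙ x) (codeℕ (grow b a)) × ⊤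
    sound true  _ _ _ = ev refl _ , tt
    sound false _ _ _ = ev refl _ , tt
    total : ∀ bs m → foldl grow m bs ≡ 2 * cnt id bs + m
    total []           m = refl
    total (false ∷ bs) m = total bs m
    total (true ∷ bs)  m = begin
      foldl grow (2 + m) bs       ≡⟨ total bs (2 + m) ⟩
      2 * cnt id bs + (2 + m)     ≡⟨ +-assoc (2 * cnt id bs) 2 m ⟨
      2 * cnt id bs + 2 + m       ≡⟨ cong (_+ m) (+-comm (2 * cnt id bs) 2) ⟩
      2 + 2 * cnt id bs + m       ≡⟨ cong (_+ m) (*-suc 2 (cnt id bs)) ⟨
      2 * suc (cnt id bs) + m     ∎
      where open ≡-Reasoning

  eq-ev : ∀ xs ys → length xs ≤ N → Ev N eqᶠ (codeBits xs ∙ codeBits ys) (codeBool (eqᵇ xs ys))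
  eq-ev xs ys le = ev-≡ (result true xs ys) (ev-∘
    (ev-fold {cA = codeBool} {cB = code} eqStep any-state sound xs (true , ys) tt le (ev refl _) (ev refl _))
    (ev refl _))
    where
    code : Bool × List Bool → Tree
    code (ok , r) = codeBool ok ∙ codeBits r
    body = condᶠ (tlᶠ accum) (condᶠ elem (condᶠ (hdᶠ (tlᶠ accum)) (hdᶠ accum) nilᶠ)
                                        (condᶠ (hdᶠ (tlᶠ accum)) nilᶠ (hdᶠ accum))) nilᶠ
           ∙ᶠ tlᶠ (tlᶠ accum)
    sound : ∀ {x} a (as : List Bool) b → ⊤ → Ev N body ((codeBool a ∙ code b) ∙ x) (code (eqStep b a)) × ⊤
    sound _     _ (_     , [])        _ = ev refl _ , tt
    sound true  _ (ok    , true ∷ _)  _ rewrite ∧-identityʳ ok = ev refl _ , tt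
    sound true  _ (ok    , false ∷ _) _ rewrite ∧-zeroʳ ok     = ev refl _ , tt
    sound false _ (ok    , true ∷ _)  _ rewrite ∧-zeroʳ ok     = ev refl _ , tt
    sound false _ (ok    , false ∷ _) _ rewrite ∧-identityʳ ok = ev refl _ , tt
    failed : ∀ xs → ite (codeBits (proj₂ (foldl eqStep (false , []) xs))) nil (codeBool (proj₁ (foldl eqStep (false , []) xs))) ≡ nil
    failed []       = refl
    failed (x ∷ xs) = failed xs
    result : ∀ ok xs ys → ite (codeBits (proj₂ (foldl eqStep (ok , ys) xs))) nil (codeBool (proj₁ (foldl eqStep (ok , ys) xs)))
             ≡ codeBool (ok ∧ eqᵇ xs ys)
    result ok []       []       = cong codeBool (sym (∧-identityʳ ok))
    result ok []       (y ∷ ys) = cong codeBool (sym (∧-zeroʳ ok))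
    result ok (x ∷ xs) []       = trans (failed xs) (cong codeBool (sym (∧-zeroʳ ok)))
    result ok (x ∷ xs) (y ∷ ys) = trans (result (ok ∧ (x == y)) xs ys) (cong codeBool (∧-assoc ok (x == y) (eqᵇ xs ys)))

  Valid : Label → Set
  Valid x = idx x ≤ N × length (bits x) ≤ N

  count-ev : ∀ c z K → length (bits z) ≤ N → length K ≤ N →
             Ev N countᶠ (codeℕ c ∙ codeLabel z ∙ codeLabels K) (codeℕ (c ∸ cnt (isLo (bits z)) K))
  count-ev c z K leb leK = ev-≡ (cong codeℕ (total K c))
    (ev-fold {cA = codeLabel} {cB = codeℕ} (λ m x → decrease (isLo (bits z) x) m) any-state sound K c tt leK (ev refl _) (ev refl _))
    where
    x₀ = codeℕ c ∙ codeLabel z ∙ codeLabels K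
    same = condᶠ (hdᶠ elem) nilᶠ (eqᶠ ∘ᶠ (tlᶠ (tlᶠ (hdᶠ (tlᶠ env))) ∙ᶠ tlᶠ (tlᶠ elem)))
    same-value : ∀ y → ite (codeBool (isHi y)) nil (codeBool (eqᵇ (bits z) (bits y))) ≡ codeBool (isLo (bits z) y)
    same-value (hi _ _) = refl
    same-value (lo _)   = refl
    sound : ∀ y as m → ⊤ → Ev N (condᶠ same (tlᶠ accum) accum) ((codeLabel y ∙ codeℕ m) ∙ x₀) (codeℕ (decrease (isLo (bits z) y) m)) × ⊤
    sound y _ m _ = ev-≡ (ite-decrease (isLo (bits z) y) m)
      (ev-if (ev-≡ (same-value y) (ev-if (ev refl _) (ev refl _) (ev-∘ (ev refl _) (eq-ev (bits z) (bits y) leb))))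
             (ev refl _) (ev refl _)) , tt
    total : ∀ K m → foldl (λ m x → decrease (isLo (bits z) x) m) m K ≡ m ∸ cnt (isLo (bits z)) K
    total []      m = refl
    total (x ∷ K) m = trans (total K _) (decrease-∸ (isLo (bits z) x) m (cnt (isLo (bits z)) K))

  keep-ev : ∀ c xs → All (λ x → length (bits x) ≤ N) xs → length xs ≤ N →
            Ev N keepᶠ (codeℕ c ∙ codeLabels xs) (codeLabels (kernel c [] xs))
  keep-ev c xs short le =
    ev-fold {cA = codeLabel} {cB = codeLabels} (λ K x → keep c x K) R sound xs [] (short , subst (_≤ N) (sym (+-identityʳ _)) le) le (ev refl _) (ev refl _)
    where
    -- The second component bounds the list `K` that `countᶠ` traverses.
    R : List Label → List Label → Set
    R as K = All (λ x → length (bits x) ≤ N) as × length as + length K ≤ N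
    body = condᶠ (hdᶠ elem) (elem ∙ᶠ accum) (condᶠ (countᶠ ∘ᶠ (hdᶠ env ∙ᶠ elem ∙ᶠ accum)) (elem ∙ᶠ accum) accum)
    choice : ∀ m (A B : List Label) → ite (codeℕ (c ∸ m)) (codeLabels A) (codeLabels B) ≡ codeLabels (ifᵇ m <ᵇ c then A else B)
    choice m A B = go c m
      where
      go : ∀ c m → ite (codeℕ (c ∸ m)) (codeLabels A) (codeLabels B) ≡ codeLabels (ifᵇ m <ᵇ c then A else B)
      go zero    zero    = refl
      go zero    (suc m) = refl
      go (suc c) zero    = refl
      go (suc c) (suc m) = go c m
    sound : ∀ x as K → R (x ∷ as) K →
            Ev N body ((codeLabel x ∙ codeLabels K) ∙ (codeℕ c ∙ codeLabels xs)) (codeLabels (keep c x K)) × R as (keep c x K)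
    sound x as K (p ∷ ps , le) = ev-≡ (value x)
        (ev-if (ev refl _) (ev refl _) (ev-≡ (choice (cnt (isLo (bits x)) K) (x ∷ K) K)
          (ev-if (ev-∘ (ev refl _) (count-ev c x K p (≤-trans (m≤n+m _ (suc (length as))) le))) (ev refl _) (ev refl _)))) ,
      ps , ≤-trans (+-monoʳ-≤ (length as) (length-keep x)) (subst (_≤ N) (sym (+-suc (length as) (length K))) le)
      where
      value : ∀ x → ite (codeBool (isHi x)) (codeLabels (x ∷ K)) (codeLabels (ifᵇ cnt (isLo (bits x)) K <ᵇ c then x ∷ K else K))
              ≡ codeLabels (keep c x K)
      value (hi _ _) = refl
      value (lo _)   = refl
      length-keep : ∀ x → length (keep c x K) ≤ suc (length K)
      length-keep (hi _ _) = ≤-refl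
      length-keep (lo b) with cnt (isLo b) K <ᵇ c
      ... | true  = ≤-refl
      ... | false = n≤1+n _

foldl-∷ : ∀ {A : Set} {n m} (f : Fin n → A) (e : Fin m → Fin n) b →
          foldl (λ b u → f u ∷ b) b (tabulate e) ≡ tabulate (f ∘ e) ʳ++ b
foldl-∷ {m = zero}  f e b = refl
foldl-∷ {m = suc m} f e b = foldl-∷ f (e ∘ suc) (f (e zero) ∷ b)

-- The kernel computed from the adjacency matrix

module GraphPrograms {N n} (G : Graph n) (n≤N : n ≤ N) where
  open Labelling G

  rowCode : Fin n → Tree
  rowCode u = codeList (tabulate (λ v → codeBool (adj G u v)))

  rowCode-bits : ∀ u → rowCode u ≡ codeBits (tabulate (adj G u))
  rowCode-bits u = cong codeList (sym (map-tabulate (adj G u) codeBool))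

  rows : Tree
  rows = codeGraph G

  rows-map : rows ≡ codeList (map rowCode (allFin n))
  rows-map = cong codeList (sym (map-tabulate id rowCode))

  tabulate≤N : ∀ {A : Set} (f : Fin n → A) → length (tabulate f) ≤ N
  tabulate≤N f = subst (_≤ N) (sym (length-tabulate f)) n≤N

  mask : List Bool
  mask = tabulate (high G)

  rev-tabulate-ev : ∀ {A : Set} {c : A → Tree} (f : Fin n → A) →
                    Ev N revᶠ (codeList (map c (reverse (tabulate f)))) (codeList (map c (tabulate f)))
  rev-tabulate-ev {c = c} f = ev-≡ (cong (codeList ∘ map c) (reverse-involutive (tabulate f)))
    (rev-ev {c = c} (reverse (tabulate f)) (subst (_≤ N) (sym (length-reverse (tabulate f))) (tabulate≤N f)))

  mask-ev : Ev N maskᶠ rows (codeBits mask)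
  mask-ev = ev-∘ (ev-≡ (cong codeBits (foldl-∷ (high G) id []))
      (ev-fold {cA = rowCode} {cB = codeBits} (λ b u → high G u ∷ b) any-state
        (λ u _ _ _ → ev-∙ (ev-∘ (ev refl _) (row-high u)) (ev refl _) , tt)
        (allFin n) [] tt (tabulate≤N id) (ev rows-map _) (ev refl _)))
    (rev-tabulate-ev {c = codeBool} (high G))
    where
    row-high : ∀ u → Ev N highᶠ (rowCode u ∙ rows) (codeBool (high G u))
    row-high u = subst (λ r → Ev N highᶠ (r ∙ rows) (codeBool (high G u))) (sym (rowCode-bits u))
      (ev-≡ (cong₂ (λ l d → codeBool (l ≤ᵇ d + d)) (length-tabulate rowCode) (∑-tabulate (adj G u) bit))
            (high-ev (tabulate (adj G u)) (tabulate rowCode) (tabulate≤N (adj G u))))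

  State : Set
  State = List Bool × ℕ × List Label

  headOr : List Bool → Bool
  headOr []      = false
  headOr (b ∷ _) = b

  labelStep : State → Fin n → State
  labelStep (m , i , out) u = drop 1 m , suc i , mkLabel (headOr m) i (row u) ∷ out

  -- Stated for a stretch `e` of consecutive vertices beginning at index `i`, so that the running
  -- counter agrees with `toℕ` throughout the induction.
  labelStep-tabulate : ∀ {m} (e : Fin m → Fin n) i out → (∀ j → toℕ (e j) ≡ i + toℕ j) →
    foldl labelStep (tabulate (high G ∘ e) , i , out) (tabulate e) ≡ ([] , i + m , tabulate (label ∘ e) ʳ++ out)
  labelStep-tabulate {zero} e i out eq = cong (λ i → [] , i , out) (sym (+-identityʳ i))
  labelStep-tabulate {suc m} e i out eq
    rewrite trans (sym (+-identityʳ i)) (sym (eq zero)) =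
    trans (labelStep-tabulate (e ∘ suc) (suc (toℕ (e zero))) (label (e zero) ∷ out)
            (λ j → trans (eq (suc j)) (trans (+-suc i (toℕ j)) (cong (λ i → suc (i + toℕ j)) i≡))))
          (cong (λ i → [] , i , tabulate (label ∘ e ∘ suc) ʳ++ label (e zero) ∷ out) (sym (+-suc (toℕ (e zero)) m)))
    where
    i≡ : i ≡ toℕ (e zero)
    i≡ = trans (sym (+-identityʳ i)) (sym (eq zero))

  labels-ev : Ev N labelsᶠ (codeBits mask ∙ rows) (codeLabels labels)
  labels-ev = ev-∘ (ev-≡ (cong (λ s → codeLabels (proj₂ (proj₂ s))) (labelStep-tabulate id 0 [] (λ _ → refl)))
      (ev-tl (ev-tl (ev-fold {cA = rowCode} {cB = code} labelStep any-state
        (λ u _ s _ → sound u s , tt) (allFin n) (mask , 0 , []) tt (tabulate≤N id) (ev rows-map _) (ev refl _)))))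
    (rev-tabulate-ev {c = codeLabel} label)
    where
    code : State → Tree
    code (m , i , out) = codeBits m ∙ codeℕ i ∙ codeLabels out
    labelᶠ body : Fun
    labelᶠ = condᶠ (hdᶠ (hdᶠ accum)) 𝟏 nilᶠ ∙ᶠ condᶠ (hdᶠ (hdᶠ accum)) (hdᶠ (tlᶠ accum)) nilᶠ ∙ᶠ (rowᶠ ∘ᶠ (hdᶠ env ∙ᶠ elem))
    body = tlᶠ (hdᶠ accum) ∙ᶠ (nilᶠ ∙ᶠ hdᶠ (tlᶠ accum)) ∙ᶠ labelᶠ ∙ᶠ tlᶠ (tlᶠ accum)
    row-bits : ∀ u → Ev N rowᶠ (codeBits mask ∙ rowCode u) (codeBits (row u))
    row-bits u = subst (λ r → Ev N rowᶠ (codeBits mask ∙ r) (codeBits (row u))) (sym (rowCode-bits u))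
                       (row-ev (high G) (adj G u) n≤N)
    sound : ∀ u s → Ev N body ((rowCode u ∙ code s) ∙ (codeBits mask ∙ rows)) (code (labelStep s u))
    sound u (m , i , out) = ev-∙ (ev (tl-codeList m) _) (ev-∙ (ev refl _) (ev-∙ (lab m) (ev refl _)))
      where
      lab : ∀ m → Ev N labelᶠ ((rowCode u ∙ code (m , i , out)) ∙ (codeBits mask ∙ rows)) (codeLabel (mkLabel (headOr m) i (row u)))
      lab []          = ev-∙ (ev refl _) (ev-∙ (ev refl _) (ev-∘ (ev refl _) (row-bits u)))
      lab (true ∷ _)  = ev-∙ (ev refl _) (ev-∙ (ev refl _) (ev-∘ (ev refl _) (row-bits u)))
      lab (false ∷ _) = ev-∙ (ev refl _) (ev-∙ (ev refl _) (ev-∘ (ev refl _) (row-bits u)))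

  label-valid : ∀ u → Valid {N} (label u)
  label-valid u = valid (high G u)
    where
    valid : ∀ c → Valid {N} (mkLabel c (toℕ u) (row u))
    valid true  = ≤-trans (<⇒≤ (toℕ<n u)) n≤N , tabulate≤N _
    valid false = z≤n , tabulate≤N _

  core-valid : All (Valid {N}) (core G)
  core-valid = kernel-all labels [] (tabulate⁺ label-valid) []

  core-length : length (core G) ≤ N
  core-length = ≤-trans (kernel-length labels [])
    (subst (_≤ N) (sym (+-identityʳ _)) (tabulate≤N label))

  kernel-ev : Ev N kernelᶠ rows (codeLabels (core G))
  kernel-ev = ev-∘ (ev-∘ (ev-∙ mask-ev (ev refl _)) (ev-∙ (ev-∘ (ev refl _) budget) labels-ev))
    (keep-ev (suc (2 * highs G)) labels (tabulate⁺ (λ u → proj₂ (label-valid u))) (tabulate≤N label))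
    where
    budget : Ev N budgetᶠ (codeBits mask) (codeℕ (suc (2 * highs G)))
    budget = ev-≡ (cong (λ h → codeℕ (suc (2 * h))) (∑-tabulate (high G) bit)) (budget-ev mask (tabulate≤N (high G)))

-- The search through all orderings of the kernel

found : ℕ → Bool → List Label → Bool
found k b p = (breaks clash p <ᵇ k) ∨ b

module _ {N : ℕ} where

  Inserting : Set
  Inserting = List Label × List Label × List (List Label)

  codeInserting : Inserting → Tree
  codeInserting (xs , ys , ps) = codeLabels xs ∙ codeLabels ys ∙ codePerms ps

  finish : Label → Inserting → List (List Label)
  finish x (xs , ys , ps) = (xs ʳ++ x ∷ ys) ∷ ps

  -- A fold shows only the current element, so the suffix that is still to follow is kept in the
  -- state.
  insertStep : Label → Inserting → Label → Inserting
  insertStep x s@(xs , ys , ps) y = y ∷ xs , drop 1 ys , finish x s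

  inserted-ev : ∀ x s → length (proj₁ s) ≤ N →
                Ev N insertedᶠ (codeLabel x ∙ codeInserting s) (codePerms (finish x s))
  inserted-ev x (xs , ys , ps) le = ev-∙ (ev-∘ (ev refl _) (revApp-ev {c = codeLabel} xs (x ∷ ys) le)) (ev refl _)

  inserts-fold : ∀ x xs ys ps → finish x (foldl (insertStep x) (xs , ys , ps) ys) ≡ inserts x xs ys ps
  inserts-fold x xs []       ps = refl
  inserts-fold x xs (y ∷ ys) ps = inserts-fold x (y ∷ xs) ys _

  inserts-ev : ∀ x p ps → length p ≤ N →
               Ev N insertsᶠ (codeLabel x ∙ codeLabels p ∙ codePerms ps) (codePerms (inserts x [] p ps))
  inserts-ev x p ps le = ev-≡ (cong codePerms (inserts-fold x [] p ps)) (ev-∘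
    (ev-∙ (ev refl _) (ev-fold {cA = codeLabel} {cB = codeInserting} (insertStep x) R sound p ([] , p , ps)
                         (subst (_≤ N) (sym (+-identityʳ (length p))) le) le (ev refl _) (ev refl _)))
    (inserted-ev x _ (final p _ (subst (_≤ N) (sym (+-identityʳ (length p))) le))))
    where
    R : List Label → Inserting → Set
    R as s = length as + length (proj₁ s) ≤ N
    body : Fun
    body = (elem ∙ᶠ hdᶠ accum) ∙ᶠ tlᶠ (hdᶠ (tlᶠ accum)) ∙ᶠ insertedᶠ ∘ᶠ (hdᶠ env ∙ᶠ accum)
    next : ∀ {y as s} → R (y ∷ as) s → R as (insertStep x s y)
    next {as = as} r = subst (_≤ N) (sym (+-suc (length as) _)) r
    sound : ∀ y as s → R (y ∷ as) s →
            Ev N body ((codeLabel y ∙ codeInserting s) ∙ (codeLabel x ∙ codeLabels p ∙ codePerms ps)) (codeInserting (insertStep x s y))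
            × R as (insertStep x s y)
    sound y as s@(xs , ys , _) r =
      ev-∙ (ev refl _) (ev-∙ (ev (tl-codeList ys) _) (ev-∘ (ev refl _) (inserted-ev x s (≤-trans (m≤n+m _ (suc (length as))) r)))) ,
      next {y} {as} {s} r
    final : ∀ as s → R as s → length (proj₁ (foldl (insertStep x) s as)) ≤ N
    final []       s r = r
    final (a ∷ as) s r = final as _ (next {a} {as} {s} r)

  insertAll-ev : ∀ x ps → length ps ≤ N → All (λ p → length p ≤ N) ps →
                 Ev N insertAllᶠ (codeLabel x ∙ codePerms ps) (codePerms (insertAll x ps []))
  insertAll-ev x ps le short =
    ev-fold {cA = codeLabels} {cB = codePerms} (λ acc p → inserts x [] p acc) (λ as _ → All (λ p → length p ≤ N) as)
      sound ps [] short le (ev refl _) (ev refl _)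
    where
    sound : ∀ p as acc → All (λ p → length p ≤ N) (p ∷ as) →
            Ev N (insertsᶠ ∘ᶠ (hdᶠ env ∙ᶠ elem ∙ᶠ accum)) ((codeLabels p ∙ codePerms acc) ∙ (codeLabel x ∙ codePerms ps))
               (codePerms (inserts x [] p acc)) × All (λ p → length p ≤ N) as
    sound p as acc (l ∷ ls) = ev-∘ (ev refl _) (inserts-ev x p acc l) , ls

  perms-ev : ∀ K → length K ≤ N → length K ^ length K ≤ N → Ev N permsᶠ (codeLabels K) (codePerms (allPerms K))
  perms-ev K le le^ =
    ev-fold {cA = codeLabel} {cB = codePerms} (λ ps x → insertAll x ps []) R sound K ([] ∷ []) start le (ev refl _) (ev refl _)
    where
    s = length K
    -- The last component says that even if every remaining insertion multiplies the number of lists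
    -- by `s`, it stays at most `s ^ s`; this bounds every intermediate list.
    R : List Label → List (List Label) → Set
    R as ps = ∃[ zs ] (Enumerates ps zs × length zs + length as ≡ s × length ps * s ^ length as ≤ s ^ s)
    start : R K ([] ∷ [])
    start = [] , (↭-refl ∷ [] , λ p → here (↭-empty-inv p)) , refl , ≤-reflexive (*-identityˡ _)
    sound : ∀ x as ps → R (x ∷ as) ps →
            Ev N (insertAllᶠ ∘ᶠ (elem ∙ᶠ accum)) ((codeLabel x ∙ codePerms ps) ∙ codeLabels K) (codePerms (insertAll x ps []))
            × R as (insertAll x ps [])
    sound x as ps (zs , e , total , le′) =
      ev-∘ (ev refl _) (insertAll-ev x ps (≤-trans length≤ le^) short) ,
      x ∷ zs , insertAll-enumerates x e , total′ , ≤-trans grows le′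
      where
      total′ : suc (length zs) + length as ≡ s
      total′ = trans (sym (+-suc (length zs) (length as))) total
      suc≤s : suc (length zs) ≤ s
      suc≤s = subst (suc (length zs) ≤_) total′ (m≤m+n _ _)
      length≤ : length ps ≤ s ^ s
      length≤ = ≤-trans (m≤m*n (length ps) (s ^ suc (length as)) {{m^n≢0 s (suc (length as)) {{>-nonZero (≤-trans (s≤s z≤n) suc≤s)}}}}) le′
      short : All (λ p → length p ≤ N) ps
      short = All.map (λ p → ≤-trans (≤-trans (≤-reflexive (↭-length p)) (<⇒≤ suc≤s)) le) (proj₁ e)
      grows : length (insertAll x ps []) * s ^ length as ≤ length ps * s ^ suc (length as)
      grows = begin
        length (insertAll x ps []) * s ^ length as  ≡⟨ cong (_* s ^ length as) (trans (length-insertAll x ps [] (proj₁ e)) (+-identityʳ _)) ⟩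
        length ps * suc (length zs) * s ^ length as ≤⟨ *-monoˡ-≤ (s ^ length as) (*-monoʳ-≤ (length ps) suc≤s) ⟩
        length ps * s * s ^ length as               ≡⟨ *-assoc (length ps) s _ ⟩
        length ps * s ^ suc (length as)             ∎
        where open ≤-Reasoning

  clash-ev : ∀ x y → Valid {N} x → Valid {N} y → Ev N clashᶠ (codeLabel x ∙ codeLabel y) (codeBool (clash x y))
  clash-ev x y (ix , _) (iy , _) = ev-≡ (value x y)
    (ev-if (ev refl _) (ev-∘ (ev refl _) (at-ev (idx x) (bits y) ix))
           (ev-if (ev refl _) (ev-∘ (ev refl _) (at-ev (idx y) (bits x) iy)) (ev refl _)))
    where
    value : ∀ x y → ite (codeBool (isHi x)) (codeBool (bits y at idx x)) (ite (codeBool (isHi y)) (codeBool (bits x at idx y)) nil)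
            ≡ codeBool (clash x y)
    value (hi _ _) y        = refl
    value (lo _)   (hi _ _) = refl
    value (lo _)   (lo _)   = refl

  breaks-ev : ∀ p k → All (Valid {N}) p → length p ≤ N →
              Ev N breaksᶠ (codeLabels p ∙ codeℕ k) (codeℕ (k ∸ breaks clash p))
  breaks-ev p k valid le = ev-≡ (cong codeℕ (trans (total (lo []) k p) (cong (k ∸_) (first p))))
    (ev-tl (ev-fold {cA = codeLabel} {cB = code} step R sound p (lo [] , k) ((z≤n , z≤n) , valid) le (ev refl _) (ev refl _)))
    where
    code : Label × ℕ → Tree
    code (x , m) = codeLabel x ∙ codeℕ m
    step : Label × ℕ → Label → Label × ℕ
    step (x , m) y = y , decrease (clash x y) m
    R : List Label → Label × ℕ → Set
    R as (x , _) = Valid {N} x × All (Valid {N}) as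
    sound : ∀ y as s → R (y ∷ as) s →
            Ev N (elem ∙ᶠ condᶠ (clashᶠ ∘ᶠ (hdᶠ accum ∙ᶠ elem)) (tlᶠ (tlᶠ accum)) (tlᶠ accum))
               ((codeLabel y ∙ code s) ∙ (codeLabels p ∙ codeℕ k)) (code (step s y)) × R as (step s y)
    sound y as (x , m) (vx , vy ∷ vs) =
      ev-∙ (ev refl _) (ev-≡ (ite-decrease (clash x y) m) (ev-if (ev-∘ (ev refl _) (clash-ev x y vx vy)) (ev refl _) (ev refl _))) ,
      vy , vs
    total : ∀ x m ys → proj₂ (foldl step (x , m) ys) ≡ m ∸ breaks clash (x ∷ ys)
    total x m []       = refl
    total x m (y ∷ ys) = trans (total y _ ys) (decrease-∸ (clash x y) m (breaks clash (y ∷ ys)))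
    first : ∀ p → breaks clash (lo [] ∷ p) ≡ breaks clash p
    first []           = refl
    first (hi _ _ ∷ _) = refl
    first (lo _ ∷ _)   = refl

  check-ev : ∀ ps k → All (λ p → All (Valid {N}) p × length p ≤ N) ps → length ps ≤ N →
             Ev N checkᶠ (codePerms ps ∙ codeℕ k) (codeBool (foldl (found k) false ps))
  check-ev ps k valid le =
    ev-fold {cA = codeLabels} {cB = codeBool} (found k) R sound ps false valid le (ev refl _) (ev refl _)
    where
    R : List (List Label) → Bool → Set
    R as _ = All (λ p → All (Valid {N}) p × length p ≤ N) as
    choice : ∀ k m b → ite (codeℕ (k ∸ m)) (nil ∙ nil) (codeBool b) ≡ codeBool ((m <ᵇ k) ∨ b)
    choice zero    zero    b = refl
    choice zero    (suc m) b = refl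
    choice (suc k) zero    b = refl
    choice (suc k) (suc m) b = choice k m b
    sound : ∀ p as b → R (p ∷ as) b →
            Ev N (condᶠ (breaksᶠ ∘ᶠ (elem ∙ᶠ tlᶠ env)) 𝟏 accum) ((codeLabels p ∙ codeBool b) ∙ (codePerms ps ∙ codeℕ k))
               (codeBool (found k b p)) × R as (found k b p)
    sound p as b ((v , l) ∷ vs) =
      ev-≡ (choice k (breaks clash p) b) (ev-if (ev-∘ (ev refl _) (breaks-ev p k v l)) (ev refl _) (ev refl _)) , vs

-- Correctness of the answer

found-sound : ∀ k b ps → foldl (found k) b ps ≡ true → b ≡ false → ∃[ p ] (p ∈ ps × breaks clash p < k)
found-sound k b [] eq eq′ with () ← trans (sym eq) eq′
found-sound k b (p ∷ ps) eq eq′ with breaks clash p <ᵇ k in lt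
... | true  = p , here refl , <ᵇ⇒< _ k (subst T (sym lt) tt)
... | false with found-sound k b ps eq eq′
...   | q , q∈ , l = q , there q∈ , l

found-true : ∀ k ps → foldl (found k) true ps ≡ true
found-true k []       = refl
found-true k (p ∷ ps) rewrite ∨-zeroʳ (breaks clash p <ᵇ k) = found-true k ps

found-complete : ∀ {p} k b ps → p ∈ ps → breaks clash p < k → foldl (found k) b ps ≡ true
found-complete k b (p ∷ ps) (here refl) lt with breaks clash p <ᵇ k | <⇒<ᵇ lt
... | true | _ = found-true k ps
found-complete k b (_ ∷ ps) (there p∈) lt = found-complete k _ ps p∈ lt

module _ {n} (G : Graph n) (k : ℕ) where

  answer : Bool
  answer = foldl (found k) false (allPerms (core G))

  answer-reflects : NonZero k → Reflects (PathCover (complement G) k) answer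
  answer-reflects k≢0 with answer in eq
  ... | true  = let p , p∈ , lt = found-sound k false (allPerms (core G)) eq refl
                in ofʸ (arrangeable⇒cover G (proj₂ (kernel-correct G)
                     (p , All.lookup (proj₁ (allPerms-enumerates (core G))) p∈ , lt)))
  ... | false = ofⁿ λ cover → let σ , perm , lt = proj₁ (kernel-correct G) (cover⇒arrangeable G k≢0 cover) in
                  contradiction (trans (sym eq) (found-complete k false (allPerms (core G)) (proj₂ (allPerms-enumerates (core G)) perm) lt)) λ ()

  main-ev : ∀ {N} → n ≤ N → length (core G) ^ length (core G) ≤ N →
            Ev N mainᶠ (codeGraph G ∙ codeℕ k) (codeBool answer)
  main-ev {N} n≤N le^ = ev-∘
    (ev-∙ (ev-∘ (ev-∘ (ev refl _) kernel-ev) (perms-ev (core G) core-length le^)) (ev refl _))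
    (check-ev (allPerms (core G)) k
      (All.map (λ p → All-resp-↭ (↭-sym p) core-valid , subst (_≤ N) (sym (↭-length p)) core-length)
               (proj₁ (allPerms-enumerates (core G))))
      (≤-trans (length-allPerms (core G)) le^))
    where open GraphPrograms {N} G n≤N

-- The parameterized time bound

-- `size-bound` is the bound of `kernel-size` with the number of high vertices replaced by
-- `4 * suc w`.
size-bound permutation-bound : ℕ → ℕ
size-bound w = 4 * suc w + 2 ^ (4 * suc w) * suc (2 * (4 * suc w))
permutation-bound w = size-bound w ^ size-bound w

permutations≤ : ∀ {n} (G : Graph n) w → TreeWidthAtMost G w → length (core G) ^ length (core G) ≤ permutation-bound w
permutations≤ G w tw = ≤-trans (^-monoˡ-≤ (length (core G)) small) (^-monoʳ-≤ (size-bound w) small)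
  where
  few : highs G ≤ 4 * suc w
  few = few-high G w tw
  small : length (core G) ≤ size-bound w
  small = ≤-trans (kernel-size G) (+-mono-≤ few (*-mono-≤ (^-monoʳ-≤ 2 few) (s≤s (*-monoʳ-≤ 2 few))))

permutation-bound-computes : ∃ (_Computes permutation-bound)
permutation-bound-computes = size ^ᶜ size
  where
  four : ∃ (_Computes (λ w → 4 * suc w))
  four = const-computes 4 *ᶜ (const-computes 1 +ᶜ id-computes)
  size : ∃ (_Computes size-bound)
  size = four +ᶜ const-computes 2 ^ᶜ four *ᶜ (const-computes 1 +ᶜ const-computes 2 *ᶜ four)

^-distribʳ-* : ∀ d m n → (m * n) ^ d ≡ m ^ d * n ^ d
^-distribʳ-* zero    m n = refl
^-distribʳ-* (suc d) m n = trans (cong (m * n *_) (^-distribʳ-* d m n)) ([m*n]*[o*p]≡[m*o]*[n*p] m n (m ^ d) (n ^ d))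

suc-+≤* : ∀ a b → suc (a + b) ≤ suc a * suc b
suc-+≤* a b = s≤s (≤-trans (≤-reflexive (+-comm a b)) (+-monoʳ-≤ b (m≤m*n a (suc b))))

module _ (P : ParameterizedProblem) where
  open ParameterizedProblem P

  -- The polynomial bounding `cap f` is taken at `F w + size x`; `suc-+≤*` separates parameter from
  -- size, and the factor that depends on `w` becomes the function demanded by `FPT`.
  bounded⇒FPT : ∀ f {F} → ∃ (_Computes F) →
                (∀ x w → ParamAtMost x w →
                   ∃[ b ] (Ev (F w + size x) f (code x) (codeBool b) × Reflects (Yes x) b)) → FPT P
  bounded⇒FPT f {F} F-computes solve with poly-cap f
  ... | c , d , cap≤ =
    toProgram f , (λ w → c * suc (F w) ^ d) , d ,
    computable (const-computes c *ᶜ (const-computes 1 +ᶜ F-computes) ^ᶜ const-computes d) ,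
    λ x w w-bounds → let b , ev value bounded , reflects = solve x w w-bounds in
      b , (toRun f (code x) value , ≤-trans (time≤cap f bounded) (cap-bound (F w) (size x))) , reflects
    where
    open ≤-Reasoning
    cap-bound : ∀ a n → cap f (a + n) ≤ c * suc a ^ d * suc n ^ d
    cap-bound a n = begin
      cap f (a + n)               ≤⟨ cap≤ (a + n) ⟩
      c * suc (a + n) ^ d         ≤⟨ *-monoʳ-≤ c (^-monoˡ-≤ d (suc-+≤* a n)) ⟩
      c * (suc a * suc n) ^ d     ≡⟨ cong (c *_) (^-distribʳ-* d (suc a) (suc n)) ⟩
      c * (suc a ^ d * suc n ^ d) ≡⟨ *-assoc c (suc a ^ d) (suc n ^ d) ⟨
      c * suc a ^ d * suc n ^ d   ∎

theorem1 : FPT AntiPathCover-by-TreeWidth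
theorem1 = bounded⇒FPT AntiPathCover-by-TreeWidth mainᶠ permutation-bound-computes solve
  where
  open GraphAndNumber
  solve : ∀ x w → TreeWidthAtMost (graph x) w →
          ∃[ b ] (Ev (permutation-bound w + n x) mainᶠ (codeGraph (graph x) ∙ codeℕ (k x)) (codeBool b) ×
                  Reflects (PathCover (complement (graph x)) (k x)) b)
  solve x w tw = answer (graph x) (k x) ,
    -- One bound has to cover both the lists of length n and the list of orderings, hence the sum.
    main-ev (graph x) (k x) (m≤n+m (n x) (permutation-bound w)) (≤-trans (permutations≤ (graph x) w tw) (m≤m+n _ (n x))) ,
    answer-reflects (graph x) (k x) (positive x)
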